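{- Every $C_5$-chain satisfies the Erdős–Hajnal Conjecture: for every $C_5$-chain $H$ there exists $\epsilon(H)>0$ such that every tournament $T$ not containing $H$ as a subtournament contains a transitive subtournament on at least $|T|^{\epsilon(H)}$ vertices.
   Context: Tournaments are finite; subtournament = induced subtournament; transitive = no directed cycle. Given an ordering of the vertex set of a tournament, an edge $(x,y)$ is backward if $y$ precedes $x$; a tournament on an ordered vertex set is determined by its set of backward edges. Product: for tournaments $H_1,H_2$ with disjoint vertex sets and injective $f_1:V(H_1)\to\mathbb{N}$, $f_2:V(H_2)\to\mathbb{N}$ with disjoint images, let $\theta_i$ order $V(H_i)$ by increasing $f_i$ and $\theta$ order $V(H_1)\cup V(H_2)$ by increasing value of $f_1$ on $V(H_1)$ and $f_2$ on $V(H_2)$; $H_1^{f_1}\oplus H_2^{f_2}$ is the tournament on $V(H_1)\cup V(H_2)$ whose backward edges under $\theta$ are exactly those of $H_1$ under $\theta_1$ together with those of $H_2$ under $\theta_2$. $C_5$-chain: let $H_l$ have vertices $h_1,\dots,h_6$ with backward edges under $(h_1,\dots,h_6)$ exactly $(h_4,h_1),(h_5,h_2),(h_5,h_1),(h_6,h_3)$; $\rho_1(h_i)=i$ for $i\le5$ and $\rho_1(h_6)=7$. For an integer $t\ge0$, let $P_{2t+1}$ have vertices $p_1,\dots,p_{2t+1}$ with backward edges under $(p_1,\dots,p_{2t+1})$ exactly $(p_{2i},p_{2i-1})$, $1\le i\le t$; $\rho_2(p_{2i+1})=2i+6$ ($0\le i\le t$) and $\rho_2(p_{2i})=2i+7$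 ($1\le i\le t$). A $C_5$-chain is a tournament $H_l^{\rho_1}\oplus P_{2t+1}^{\rho_2}$. -}

module Defs where

open import Data.Nat using (ℕ; zero; suc; _+_; _*_; _<ᵇ_; _≡ᵇ_; _^_; _≤_; _<_)
open import Data.Bool using (Bool; true; false; not; _∧_; _∨_; if_then_else_)
open import Data.Fin using (Fin; zero; suc; toℕ; inject₁; fromℕ; splitAt)
open import Data.Sum using (_⊎_; inj₁; inj₂)
open import Data.Product using (Σ; ∃; _×_; _,_)
open import Relation.Binary.PropositionalEquality using (_≡_; _≢_)
open import Relation.Nullary using (¬_)
open import Function.Definitions using (Injective)

-- Digraphs / tournaments on the vertex set Fin n.
-- Adj G x y ≡ true means there is an edge (x , y), i.e. x → y.

Digraph : ℕ → Set
Digraph n = Fin n → Fin n → Bool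

IsTournament : ∀ {n} → Digraph n → Set
IsTournament {n} G =
  (∀ (x : Fin n) → G x x ≡ false) ×
  (∀ (x y : Fin n) → x ≢ y → G x y ≡ not (G y x))

induced : ∀ {n k} → Digraph n → (Fin k → Fin n) → Digraph k
induced G g x y = G (g x) (g y)

Contains : ∀ {n m} → Digraph n → Digraph m → Set
Contains {n} {m} T H =
  Σ (Fin m → Fin n) λ f → Injective _≡_ _≡_ f × (∀ i j → T (f i) (f j) ≡ H i j)

HasDirectedCycle : ∀ {k} → Digraph k → Set
HasDirectedCycle {k} G =
  Σ ℕ λ l → Σ (Fin (suc l) → Fin k) λ c →
    Injective _≡_ _≡_ c ×
    (∀ (i : Fin l) → G (c (inject₁ i)) (c (suc i)) ≡ true) ×
    G (c (fromℕ l)) (c zero) ≡ true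

Transitive : ∀ {k} → Digraph k → Set
Transitive G = ¬ HasDirectedCycle G

HasTransitiveSub : ∀ {n} → Digraph n → ℕ → Set
HasTransitiveSub {n} T k =
  Σ (Fin k → Fin n) λ g → Injective _≡_ _≡_ g × Transitive (induced T g)

-- Tournaments on an ordered vertex set given by backward edges.
-- The ordering is "increasing value of key". back x y ≡ true means
-- (x , y) is a backward edge (y precedes x).

fromBackward : ∀ {n} → (Fin n → ℕ) → (Fin n → Fin n → Bool) → Digraph n
fromBackward key back x y =
  if key x <ᵇ key y then not (back y x)
  else (if key y <ᵇ key x then back x y else false)

backwardOf : ∀ {n} → (Fin n → ℕ) → Digraph n → Fin n → Fin n → Bool
backwardOf key G x y = (key y <ᵇ key x) ∧ G x y

⊕key : ∀ {m k} → (Fin m → ℕ) → (Fin k → ℕ) → Fin (m + k) → ℕ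
⊕key {m} f₁ f₂ x with splitAt m x
... | inj₁ a = f₁ a
... | inj₂ b = f₂ b

⊕back : ∀ {m k} → Digraph m → (Fin m → ℕ) → Digraph k → (Fin k → ℕ) →
        Fin (m + k) → Fin (m + k) → Bool
⊕back {m} H₁ f₁ H₂ f₂ x y with splitAt m x | splitAt m y
... | inj₁ a | inj₁ b = backwardOf f₁ H₁ a b
... | inj₂ a | inj₂ b = backwardOf f₂ H₂ a b
... | _      | _      = false

product : ∀ {m k} → Digraph m → (Fin m → ℕ) → Digraph k → (Fin k → ℕ) →
          Digraph (m + k)
product H₁ f₁ H₂ f₂ = fromBackward (⊕key f₁ f₂) (⊕back H₁ f₁ H₂ f₂)

-- C₅-chains. Vertices are 0-indexed: h_{i} ↦ i - 1, p_{j} ↦ j - 1.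

Hl-back : Fin 6 → Fin 6 → Bool
Hl-back x y =
  ((toℕ x ≡ᵇ 3) ∧ (toℕ y ≡ᵇ 0)) ∨ ((toℕ x ≡ᵇ 4) ∧ (toℕ y ≡ᵇ 1)) ∨
  ((toℕ x ≡ᵇ 4) ∧ (toℕ y ≡ᵇ 0)) ∨ ((toℕ x ≡ᵇ 5) ∧ (toℕ y ≡ᵇ 2))

Hl : Digraph 6
Hl = fromBackward toℕ Hl-back

ρ₁ : Fin 6 → ℕ
ρ₁ x = if toℕ x ≡ᵇ 5 then 7 else suc (toℕ x)

isOdd : ℕ → Bool
isOdd zero = false
isOdd (suc n) = not (isOdd n)

-- P_{2t+1} on (p₁,…,p_{2t+1}), backward edges (p_{2i},p_{2i-1}), 1 ≤ i ≤ t;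
-- in 0-indexed form: (j , j-1) for odd j.
P-back : ∀ t → Fin (suc (2 * t)) → Fin (suc (2 * t)) → Bool
P-back t x y = isOdd (toℕ x) ∧ (suc (toℕ y) ≡ᵇ toℕ x)

P : ∀ t → Digraph (suc (2 * t))
P t = fromBackward toℕ (P-back t)

-- ρ₂(p_{2i+1}) = 2i+6, ρ₂(p_{2i}) = 2i+7; 0-indexed: j even ↦ j+6, j odd ↦ j+8
ρ₂ : ∀ t → Fin (suc (2 * t)) → ℕ
ρ₂ t x = if isOdd (toℕ x) then toℕ x + 8 else toℕ x + 6

C5chain : ∀ t → Digraph (6 + suc (2 * t))
C5chain t = product Hl ρ₁ (P t) (ρ₂ t)

{-# OPTIONS --safe #-}

-- A minimal counterexample is a list A of vertices that contains no chain (transitive subset) of length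
-- |A|^(1/q), although every shorter list of vertices does. For q large, this forces an edge from Y to X
-- whenever X and Y are disjoint, X has linear size and Y has linear size or is a constant fraction of a
-- nearly optimal chain: otherwise two long chains could be concatenated. Greedily embedding the forbidden
-- tournament yields linear sets W₀ < W₁ < ⋯ between which almost all edges go forward, and W₂ may be
-- replaced by a chain.
--
-- Take a back edge w ⟶ a from W₄ to W₀ with w ⟶ y and z ⟶ a, where y precedes z in W₂. If a ⟶ y and z ⟶ w,
-- then a, y, m, z, w is a C₅ for every m between y and z, and m may be chosen as the end of a back edge
-- from W₆, whose other end serves as h₆. Otherwise there is a transitive triple w ⟶ y ⟶ a, w ⟶ a. Such a
-- triple forms a C₅ with every back edge c ⟶ b from W₃ to W₁, and r ∈ W₆ serves as h₆ if it dominates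
-- exactly one of b and c. Hence no back edge from W₃ to W₁ joins a vertex dominated by r to one that is
-- not. The same holds for unions of such neighbourhoods, which are small for one r but cover almost all of
-- W₁ together; adding one r at a time, a union of intermediate size contradicts the first paragraph.
module Submission where

open import Defs
open import Data.Bool using (Bool; true; false; not; _∧_; _∨_; if_then_else_; T)
open import Data.Bool.Properties using (not-involutive; not-¬; ¬-not; T-≡) renaming (_≟_ to _≟ᵇ_)
open import Data.Empty using (⊥; ⊥-elim)
open import Data.Fin using (Fin; zero; suc; toℕ; fromℕ; fromℕ<; inject₁; splitAt; join)
open import Data.Fin.Patterns
open import Data.Fin.Properties using (toℕ-injective; toℕ<n; toℕ-fromℕ<; all?; join-splitAt)
  renaming (_≟_ to _≟ᶠ_)
open import Data.List
  using (List; []; _∷_; _++_; length; filter; take; drop; lookup; applyUpTo; allFin)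
open import Data.List.Membership.Propositional using (_∈_; find; lose)
open import Data.List.Membership.Propositional.Properties using (∈-filter⁺; ∈-filter⁻; ∈-lookup)
open import Data.List.Properties
  using (length-take; length-drop; length-++; length-applyUpTo; length-tabulate; drop-drop; take++drop≡id)
open import Data.List.Relation.Binary.Sublist.Propositional
  using (_⊆_; []; _∷_; _∷ʳ_; ⊆-refl; ⊆-trans) renaming (lookup to ⊆-lookup)
open import Data.List.Relation.Binary.Sublist.Propositional.Properties
  using (filter-⊆; take-⊆; drop-⊆; All-resp-⊆; length-mono-≤)
open import Data.List.Relation.Unary.All as All using (All; []; _∷_)
import Data.List.Relation.Unary.All.Properties as Allₚ
open import Data.List.Relation.Unary.AllPairs using (AllPairs; []; _∷_)
import Data.List.Relation.Unary.AllPairs.Properties as AllPairsₚ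
open import Data.List.Relation.Unary.Any as Any using (Any; here; there)
import Data.List.Relation.Unary.Any.Properties as Anyₚ
open import Data.List.Relation.Unary.Unique.Propositional using (Unique)
open import Data.List.Relation.Unary.Unique.Propositional.Properties using (allFin⁺)
open import Data.Nat
open import Data.Nat.DivMod using (_/_; _%_; m≡m%n+[m/n]*n; m%n<n; m/n*n≤m; m≥n⇒m/n>0)
open import Data.Nat.Properties
open import Data.Nat.Tactic.RingSolver using (solve-∀)
open import Data.Product using (Σ; ∃; ∃₂; _×_; _,_; proj₁; proj₂)
open import Data.Sum using (_⊎_; inj₁; inj₂)
open import Function using (_∘_; case_of_)
open import Function.Bundles using (Equivalence)
open import Function.Definitions using (Injective)
open import Relation.Binary.Definitions using (tri<; tri≈; tri>)
open import Relation.Binary.PropositionalEquality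
open import Relation.Nullary using (¬_; Dec; yes; no; does; contradiction)
open import Relation.Nullary.Decidable using (map′; _×-dec_; _⊎-dec_; True; toWitness)

-- Sublists, counting and union bounds

private variable
  A : Set

AllPairs-resp-⊆ : {R : A → A → Set} {xs ys : List A} → xs ⊆ ys → AllPairs R ys → AllPairs R xs
AllPairs-resp-⊆ []         []         = []
AllPairs-resp-⊆ (y ∷ʳ s)   (_ ∷ ps)   = AllPairs-resp-⊆ s ps
AllPairs-resp-⊆ (refl ∷ s) (p ∷ ps)   = All-resp-⊆ s p ∷ AllPairs-resp-⊆ s ps

select : (A → Bool) → List A → List A
select p = filter (λ x → p x ≟ᵇ true)

count : (A → Bool) → List A → ℕ
count p []       = 0
count p (x ∷ xs) = (if p x then 1 else 0) + count p xs

module _ {p : A → Bool} where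

  length-select : ∀ xs → length (select p xs) ≡ count p xs
  length-select []       = refl
  length-select (x ∷ xs) with p x
  ... | true  = cong suc (length-select xs)
  ... | false = length-select xs

  select-⊆ : ∀ xs → select p xs ⊆ xs
  select-⊆ = filter-⊆ (λ x → p x ≟ᵇ true)

  ∈-select⁻ : ∀ {x xs} → x ∈ select p xs → x ∈ xs × p x ≡ true
  ∈-select⁻ = ∈-filter⁻ (λ x → p x ≟ᵇ true)

  ∈-select⁺ : ∀ {x xs} → x ∈ xs → p x ≡ true → x ∈ select p xs
  ∈-select⁺ = ∈-filter⁺ (λ x → p x ≟ᵇ true)

  count-⊆ : ∀ {xs ys} → xs ⊆ ys → count p xs ≤ count p ys
  count-⊆ []         = z≤n
  count-⊆ (y ∷ʳ s)   = ≤-trans (count-⊆ s) (m≤n+m _ _)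
  count-⊆ (_∷_ {x} refl s) = +-monoʳ-≤ (if p x then 1 else 0) (count-⊆ s)

  count-not : ∀ xs → count p xs + count (not ∘ p) xs ≡ length xs
  count-not []       = refl
  count-not (x ∷ xs) with p x
  ... | true  = cong suc (count-not xs)
  ... | false = trans (+-suc _ _) (cong suc (count-not xs))

  count≤length : ∀ xs → count p xs ≤ length xs
  count≤length xs = subst (count p xs ≤_) (count-not xs) (m≤m+n _ _)

  count-mono : ∀ {q : A → Bool} xs → (∀ {x} → x ∈ xs → p x ≡ true → q x ≡ true) → count p xs ≤ count q xs
  count-mono []       h = z≤n
  count-mono {q} (x ∷ xs) h with p x | q x | h (here refl)
  ... | false | b     | _ = ≤-trans (count-mono xs (h ∘ there)) (m≤n+m _ _)
  ... | true  | true  | _ = s≤s (count-mono xs (h ∘ there))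
  ... | true  | false | f = case f refl of λ ()

  count-∨ : ∀ {q : A → Bool} xs → count (λ x → p x ∨ q x) xs ≤ count p xs + count q xs
  count-∨ []       = z≤n
  count-∨ {q} (x ∷ xs) with p x | q x
  ... | false | false = count-∨ xs
  ... | false | true  = ≤-trans (s≤s (count-∨ xs)) (≤-reflexive (sym (+-suc _ _)))
  ... | true  | b     = s≤s (≤-trans (count-∨ xs) (+-monoʳ-≤ (count p xs) (m≤n+m _ _)))

  count-all : ∀ xs → (∀ {x} → x ∈ xs → p x ≡ true) → count p xs ≡ length xs
  count-all []       h = refl
  count-all (x ∷ xs) h with p x | h (here refl)
  ... | true | _ = cong suc (count-all xs (h ∘ there))

pairs : {B : Set} → (A → B → Bool) → List A → List B → ℕ
pairs R []       Y = 0
pairs R (x ∷ X) Y = count (R x) Y + pairs R X Y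

module _ {B : Set} where

  pairs-⊆ : ∀ {R : A → B → Bool} {X X′ Y Y′} → X ⊆ X′ → Y ⊆ Y′ → pairs R X Y ≤ pairs R X′ Y′
  pairs-⊆ []         t = z≤n
  pairs-⊆ (y ∷ʳ s)   t = ≤-trans (pairs-⊆ s t) (m≤n+m _ _)
  pairs-⊆ (refl ∷ s) t = +-mono-≤ (count-⊆ t) (pairs-⊆ s t)

  pairs-[] : ∀ {R : A → B → Bool} X → pairs R X [] ≡ 0
  pairs-[] []      = refl
  pairs-[] (_ ∷ X) = pairs-[] X

  pairs-∷ : ∀ {R : A → B → Bool} X y Y → pairs R X (y ∷ Y) ≡ count (λ x → R x y) X + pairs R X Y
  pairs-∷ []      y Y = refl
  pairs-∷ {R = R} (x ∷ X) y Y rewrite pairs-∷ {R = R} X y Y = lemma (if R x y then 1 else 0) (count (R x) Y) _ _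
    where
    lemma : ∀ a b c d → (a + b) + (c + d) ≡ (a + c) + (b + d)
    lemma = solve-∀

  pairs-bound : ∀ {R : A → B → Bool} {M} X Y → (∀ {x} → x ∈ X → M * count (R x) Y ≤ length Y) →
                M * pairs R X Y ≤ length X * length Y
  pairs-bound {M = M} [] Y h = ≤-reflexive (*-zeroʳ M)
  pairs-bound {R = R} {M} (x ∷ X) Y h rewrite *-distribˡ-+ M (count (R x) Y) (pairs R X Y) =
    +-mono-≤ (h (here refl)) (pairs-bound {R = R} {M} X Y (h ∘ there))

  -- Markov's inequality by double counting: the row of each `x` satisfying `p` contributes at least
  -- `length Y` to the right-hand side. Densities are compared by cross-multiplication here and
  -- below.
  markov : ∀ {R : A → B → Bool} {p : A → Bool} {M} X Y →
           (∀ {x} → x ∈ X → p x ≡ true → length Y ≤ M * count (R x) Y) →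
           count p X * length Y ≤ M * pairs R X Y
  markov [] Y h = z≤n
  markov {R = R} {p} {M} (x ∷ X) Y h rewrite *-distribˡ-+ M (count (R x) Y) (pairs R X Y) with p x | h (here refl)
  ... | true  | hx = +-mono-≤ (hx refl) (markov {R = R} {p} {M} X Y (h ∘ there))
  ... | false | _  = ≤-trans (markov {R = R} {p} {M} X Y (h ∘ there)) (m≤n+m _ _)

pairs-swap : ∀ {B : Set} {R : A → B → Bool} X Y → pairs R X Y ≡ pairs (λ y x → R x y) Y X
pairs-swap X []      = pairs-[] X
pairs-swap X (y ∷ Y) = trans (pairs-∷ X y Y) (cong (count _ X +_) (pairs-swap X Y))

pairs-cong : ∀ {B : Set} {R S : A → B → Bool} X Y → (∀ {x y} → x ∈ X → y ∈ Y → R x y ≡ true → S x y ≡ true) →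
             pairs R X Y ≤ pairs S X Y
pairs-cong []      Y h = z≤n
pairs-cong (x ∷ X) Y h = +-mono-≤ (count-mono Y (h (here refl))) (pairs-cong X Y (λ x∈X → h (there x∈X)))

≡true⇒T : ∀ {b} → b ≡ true → T b
≡true⇒T = Equivalence.from T-≡

count-none : {p : A → Bool} → ∀ xs → (∀ {x} → x ∈ xs → p x ≢ true) → count p xs ≡ 0
count-none []       h = refl
count-none {p = p} (x ∷ xs) h with p x | h (here refl)
... | true  | f = contradiction refl f
... | false | _ = count-none xs (h ∘ there)

∧-true : ∀ {a b} → a ∧ b ≡ true → a ≡ true × b ≡ true
∧-true {true} {true} refl = refl , refl

deMorgan : ∀ a b → not (a ∧ b) ≡ true → not a ∨ not b ≡ true
deMorgan true  b e = e
deMorgan false b _ = refl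

<ᵇ-true : ∀ {i j} → i < j → (i <ᵇ j) ≡ true
<ᵇ-true i<j = Equivalence.to T-≡ (<⇒<ᵇ i<j)

<ᵇ-false : ∀ {i j} → j ≤ i → (i <ᵇ j) ≡ false
<ᵇ-false {i} {j} j≤i with i <ᵇ j in eq
... | false = refl
... | true  = contradiction j≤i (<⇒≱ (<ᵇ⇒< i j (≡true⇒T eq)))

module _ (c : ℕ → A → Bool) where

  allBelow : ℕ → A → Bool
  allBelow zero    x = true
  allBelow (suc k) x = c k x ∧ allBelow k x

  allBelow-sound : ∀ {x} k → allBelow k x ≡ true → ∀ {j} → j < k → c j x ≡ true
  allBelow-sound (suc k) h j<k with m≤n⇒m<n∨m≡n j<k
  ... | inj₁ (s≤s j<k′) = allBelow-sound k (proj₂ (∧-true h)) j<k′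
  ... | inj₂ refl       = proj₁ (∧-true h)

  -- Union bound: each of the `k` tests fails for at most `n / m` elements, with the denominator
  -- cleared.
  count-not-allBelow : ∀ m n xs k → (∀ {j} → j < k → m * count (not ∘ c j) xs ≤ n) →
                       m * count (not ∘ allBelow k) xs ≤ k * n
  count-not-allBelow m n xs zero    h = ≤-reflexive (trans (cong (m *_) (count-none xs λ _ ())) (*-zeroʳ m))
  count-not-allBelow m n xs (suc k) h = begin
    m * count (not ∘ allBelow (suc k)) xs
      ≤⟨ *-monoʳ-≤ m (≤-trans (count-mono xs λ {x} _ → deMorgan (c k x) (allBelow k x)) (count-∨ xs)) ⟩
    m * (count (not ∘ c k) xs + count (not ∘ allBelow k) xs)
      ≡⟨ *-distribˡ-+ m (count (not ∘ c k) xs) _ ⟩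
    m * count (not ∘ c k) xs + m * count (not ∘ allBelow k) xs
      ≤⟨ +-mono-≤ (h ≤-refl) (count-not-allBelow m n xs k λ j<k → h (m≤n⇒m≤1+n j<k)) ⟩
    suc k * n ∎
    where
    open ≤-Reasoning

  -- If no test failed for the average number of elements, `k` times each failure count would be at
  -- most `length xs ∸ 1`, and the union bound would miss an element.
  allBelow-pigeonhole : ∀ xs k → 0 < length xs → (∀ {x} → x ∈ xs → allBelow k x ≡ false) →
                        ∃ λ j → j < k × length xs ≤ k * count (not ∘ c j) xs
  allBelow-pigeonhole xs k 0<xs h with anyUpTo? (λ j → length xs ≤? k * count (not ∘ c j) xs) k
  ... | yes found = found
  ... | no ¬found = ⊥-elim (absurd k 0<xs full few)
    where
    absurd : ∀ k {l b} → 0 < l → b ≡ l → (k ≡ 0 → b ≡ 0) × k * b ≤ k * pred l → ⊥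
    absurd zero    0<l refl (z , _) = <⇒≢ 0<l (sym (z refl))
    absurd (suc k) {suc l} 0<l refl (_ , le) = 1+n≰n (*-cancelˡ-≤ (suc k) le)
    full : count (not ∘ allBelow k) xs ≡ length xs
    full = count-all xs λ x∈ → cong not (h x∈)
    -- For `k ≡ 0` the inequality is trivial and nothing can be cancelled, so this case is carried
    -- along separately.
    few : (k ≡ 0 → count (not ∘ allBelow k) xs ≡ 0) × k * count (not ∘ allBelow k) xs ≤ k * pred (length xs)
    few = (λ { refl → count-none xs λ _ () }) ,
          count-not-allBelow k (pred (length xs)) xs k λ {j} j<k →
            ≤-pred (≤-trans (≰⇒> λ le → ¬found (j , j<k , le))
                (≤-reflexive (sym (suc-pred (length xs) {{>-nonZero 0<xs}}))))

-- Smoothing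

record Tournament (V : Set) : Set where
  field
    G     : V → V → Bool
    irr   : ∀ x → G x x ≡ false
    total : ∀ {x y} → x ≢ y → G x y ≡ not (G y x)

module Core {V : Set} (𝒯 : Tournament V) where
  open Tournament 𝒯 public

  _⟶_ : V → V → Set
  x ⟶ y = G x y ≡ true

  ⟶⇒≢ : ∀ {x y} → x ⟶ y → x ≢ y
  ⟶⇒≢ {x} e refl = case trans (sym e) (irr x) of λ ()

  ⟶-asym : ∀ {x y} → x ⟶ y → G y x ≡ false
  ⟶-asym {x} {y} e = trans (total (⟶⇒≢ e ∘ sym)) (cong not e)

  ⟶-not : ∀ {x y} → x ≢ y → G x y ≡ false → y ⟶ x
  ⟶-not n e = trans (total (n ∘ sym)) (cong not e)

  -- The pair x ∈ Vᵢ, y ∈ Vⱼ is a forward edge of the ordering V₀ < V₁ < ⋯ .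
  fw : ℕ → ℕ → V → V → Bool
  fw i j x y = if i <ᵇ j then G x y else G y x

  back : ℕ → ℕ → V → V → Bool
  back i j x y = not (fw i j x y)

  fw-< : ∀ {i j x y} → i < j → fw i j x y ≡ G x y
  fw-< i<j rewrite <ᵇ-true i<j = refl

  fw-> : ∀ {i j x y} → j < i → fw i j x y ≡ G y x
  fw-> j<i rewrite <ᵇ-false (<⇒≤ j<i) = refl

  fw-sym : ∀ {i j} → i ≢ j → ∀ x y → fw i j x y ≡ fw j i y x
  fw-sym {i} {j} i≢j x y with <-cmp i j
  ... | tri< i<j _ _ = trans (fw-< i<j) (sym (fw-> i<j))
  ... | tri≈ _ i≡j _ = contradiction i≡j i≢j
  ... | tri> _ _ j<i = trans (fw-> j<i) (sym (fw-< j<i))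

  Family : Set
  Family = ℕ → List V

  -- `Sparse` bounds the back edges of a pair of sets on average, `Smooth` those at each single
  -- vertex; `Λ` and `M` are reciprocals of densities.
  Sparse Smooth : ℕ → ℕ → Family → Set
  Sparse Λ k W = ∀ {i j} → i < k → j < k → i ≢ j →
    Λ * pairs (back i j) (W i) (W j) ≤ length (W i) * length (W j)
  Smooth M k W = ∀ {i j} → i < k → j < k → i ≢ j → ∀ {x} → x ∈ W i →
    M * count (back i j x) (W j) ≤ length (W j)

  module Smoothing (k N : ℕ) (W : Family) where

    ok : ℕ → ℕ → V → Bool
    ok i j x = (i ≡ᵇ j) ∨ (N * count (back i j x) (W j) ≤ᵇ length (W j))

    ok-sound : ∀ {i j x} → i ≢ j → ok i j x ≡ true → N * count (back i j x) (W j) ≤ length (W j)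
    ok-sound {i} {j} {x} i≢j h with i ≡ᵇ j in eq
    ... | true  = contradiction (≡ᵇ⇒≡ i j (≡true⇒T eq)) i≢j
    ... | false = ≤ᵇ⇒≤ _ _ (≡true⇒T h)

    ok-refl : ∀ i x → ok i i x ≡ true
    ok-refl i x rewrite Equivalence.to T-≡ (≡⇒≡ᵇ i i refl) = refl

    no-bad : ∀ {i} j → (∀ x → ok i j x ≡ true) → 2 * k * count (not ∘ ok i j) (W i) ≤ length (W i)
    no-bad {i} j h = subst (λ c → 2 * k * c ≤ length (W i))
      (sym (count-none (W i) λ {x} _ e → contradiction (trans (sym e) (cong not (h x))) λ ()))
      (subst (_≤ length (W i)) (sym (*-zeroʳ (2 * k))) z≤n)

    -- Markov: a vertex failing the test has more than `length (W j) / N` back edges, while the pair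
    -- has few in total. The factor `length (W j)` is cancelled, hence the separate case of an empty
    -- `W j`, where every vertex passes.
    count-not-ok : Sparse (2 * k * N) k W → ∀ {i j} → i < k → j < k →
                   2 * k * count (not ∘ ok i j) (W i) ≤ length (W i)
    count-not-ok sp {i} {j} i<k j<k with i ≟ j | length (W j) ≟ 0
    ... | yes refl | _ = no-bad i λ x → ok-refl i x
    ... | no i≢j | yes empty = no-bad j ok-empty
      where
      ok-empty : ∀ x → ok i j x ≡ true
      ok-empty x with i ≡ᵇ j
      ... | true  = refl
      ... | false = Equivalence.to T-≡ (≤⇒≤ᵇ (≤-trans (subst (N * count (back i j x) (W j) ≤_) (*-zeroʳ N)
                      (*-monoʳ-≤ N (subst (count (back i j x) (W j) ≤_) empty (count≤length (W j))))) z≤n))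
    ... | no i≢j | no nonempty = *-cancelʳ-≤ _ _ (length (W j)) {{≢-nonZero nonempty}} (begin
      2 * k * c * length (W j)                  ≡⟨ *-assoc (2 * k) c _ ⟩
      2 * k * (c * length (W j))                ≤⟨ *-monoʳ-≤ (2 * k)
          (markov {R = back i j} {M = N} (W i) (W j) bad) ⟩
      2 * k * (N * pairs (back i j) (W i) (W j)) ≡⟨ sym (*-assoc (2 * k) N _) ⟩
      2 * k * N * pairs (back i j) (W i) (W j)  ≤⟨ sp i<k j<k i≢j ⟩
      length (W i) * length (W j)               ∎)
      where
      open ≤-Reasoning
      c = count (not ∘ ok i j) (W i)
      bad : ∀ {x} → x ∈ W i → not (ok i j x) ≡ true → length (W j) ≤ N * count (back i j x) (W j)
      bad {x} _ e with i ≡ᵇ j | N * count (back i j x) (W j) ≤ᵇ length (W j) in le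
      ... | false | false = <⇒≤ (≰⇒> λ le′ → contradiction (trans (sym le) (Equivalence.to T-≡ (≤⇒≤ᵇ le′))) λ ())

    good : ℕ → V → Bool
    good i = allBelow (ok i) k

    smoothed : Family
    smoothed i = select (good i) (W i)

    -- Each of the `k` tests deletes at most a fraction `1 / (2 * k)` of `W i`.
    smoothed-large : Sparse (2 * k * N) k W → ∀ {i} → i < k → length (W i) ≤ 2 * length (smoothed i)
    smoothed-large sp {i} i<k = +-cancelʳ-≤ (2 * b) _ _ (begin
      length (W i) + 2 * b                ≤⟨ +-monoʳ-≤ (length (W i)) 2b≤ ⟩
      length (W i) + length (W i)         ≡⟨ cong (λ z → z + z) (sym (count-not (W i))) ⟩
      (g + b) + (g + b)                   ≡⟨ lemma g b ⟩
      2 * g + 2 * b                       ≡⟨ cong (λ z → 2 * z + 2 * b) (sym (length-select (W i))) ⟩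
      2 * length (smoothed i) + 2 * b     ∎)
      where
      open ≤-Reasoning
      g = count (good i) (W i)
      b = count (not ∘ good i) (W i)
      lemma : ∀ g b → (g + b) + (g + b) ≡ 2 * g + 2 * b
      lemma = solve-∀
      instance
        k≢0 : NonZero k
        k≢0 = >-nonZero (≤-trans (s≤s z≤n) i<k)
      2b≤ : 2 * b ≤ length (W i)
      2b≤ = *-cancelˡ-≤ k (≤-trans (≤-reflexive (trans (sym (*-assoc k 2 b)) (cong (_* b) (*-comm k 2))))
          (count-not-allBelow (ok i) (2 * k) _ (W i) k (count-not-ok sp i<k)))

    smoothed-⊆ : ∀ i → smoothed i ⊆ W i
    smoothed-⊆ i = select-⊆ (W i)

    -- Deletions add no back edges at `x`, but the other set may have halved; this is why
    -- `smoothing` tests with `2 * M`.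
    smoothed-smooth : Sparse (2 * k * N) k W → ∀ {i j} → i < k → j < k → i ≢ j → ∀ {x} → x ∈ smoothed i →
      N * count (back i j x) (smoothed j) ≤ 2 * length (smoothed j)
    smoothed-smooth sp i<k j<k i≢j x∈ =
      ≤-trans (*-monoʳ-≤ N (count-⊆ (smoothed-⊆ _)))
        (≤-trans (ok-sound i≢j (allBelow-sound (ok _) k (proj₂ (∈-select⁻ {p = good _} {xs = W _} x∈)) j<k))
            (smoothed-large sp j<k))

  smoothing : ∀ k M W → Sparse (2 * k * (2 * M)) k W →
    Σ Family λ W′ → (∀ i → W′ i ⊆ W i) × (∀ {i} → i < k → length (W i) ≤ 2 * length (W′ i)) × Smooth M k W′
  smoothing k M W sp = smoothed , smoothed-⊆ , smoothed-large sp , λ i<k j<k i≢j x∈ →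
    *-cancelˡ-≤ 2 (≤-trans (≤-reflexive (sym (*-assoc 2 M _))) (smoothed-smooth sp i<k j<k i≢j x∈))
    where open Smoothing k (2 * M) W

-- Sparse pairs and chains

agree : Bool → Bool → Bool
agree true  c = c
agree false c = not c

agree⇒≡ : ∀ {b c} → agree b c ≡ true → c ≡ b
agree⇒≡ {true}  e    = e
agree⇒≡ {false} {false} e = refl

AllPairs-++⁻ : {A : Set} {R : A → A → Set} → ∀ xs {ys} → AllPairs R (xs ++ ys) →
               ∀ {x y} → x ∈ xs → y ∈ ys → R x y
AllPairs-++⁻ (x ∷ xs) (p ∷ ps) (here refl) y∈ = All.lookup p (Anyₚ.++⁺ʳ xs y∈)
AllPairs-++⁻ (x ∷ xs) (p ∷ ps) (there x∈)  y∈ = AllPairs-++⁻ xs ps x∈ y∈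

take-drop-related : {A : Set} {R : A → A → Set} → ∀ n {xs} → AllPairs R xs →
                    ∀ {x y} → x ∈ take n xs → y ∈ drop n xs → R x y
take-drop-related {R = R} n {xs} ps = AllPairs-++⁻ (take n xs) (subst (AllPairs R) (sym (take++drop≡id n xs)) ps)

-- The factor lost in `greedy`: each placed vertex costs `Λ`, and the pigeonhole costs the number of
-- remaining sets, which `suc h` covers.
loss : ℕ → ℕ → ℕ
loss Λ zero    = 0
loss Λ (suc h) = loss Λ h * Λ + suc h

module _ {V : Set} (𝒯 : Tournament V) where
  open Core 𝒯

  Agrees IsCopy : ℕ → (ℕ → ℕ → Bool) → (ℕ → V) → Set
  Agrees h H f = ∀ {i j} → i < j → j < h → G (f i) (f j) ≡ H i j
  IsCopy h H f = Agrees h H f × (∀ {i j} → i < j → j < h → f i ≢ f j)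

  record Lopsided (Λ h : ℕ) (W : Family) (s K : ℕ) : Set where
    field
      {iX iY} : ℕ
      X Y     : List V
      dir     : Bool
      iX<iY   : iX < iY
      iY<h    : iY < h
      X⊆      : X ⊆ W iX
      Y⊆      : Y ⊆ W iY
      X-large : s ≤ K * length X
      Y-large : s ≤ K * length Y
      few     : ∀ {x} → x ∈ X → Λ * count (agree dir ∘ G x) Y ≤ length Y

  module _ (Λ : ℕ) where

    cons : V → (ℕ → V) → ℕ → V
    cons x f zero    = x
    cons x f (suc i) = f i

    -- Vertex 0 of `H` goes to an `x` in `W 0` that keeps a fraction `1 / Λ` of every later set in
    -- the required direction, and the rest is embedded among these neighbours. If there is no such
    -- `x`, the pigeonhole gives one later set towards which a constant fraction of `W 0` is
    -- deficient: a lopsided pair.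
    greedy : ∀ h (H : ℕ → ℕ → Bool) L s W → V → 0 < s → (∀ {i} → i < h → s ≤ L * length (W i)) →
             (∃ λ f → (∀ {i} → i < h → f i ∈ W i) × Agrees h H f) ⊎ Lopsided Λ h W s (loss Λ h * L)
    -- `v` is the default value of the embedding at indices beyond its domain.
    greedy zero    H L s W v 0<s large = inj₁ ((λ _ → v) , (λ ()) , λ _ ())
    greedy (suc h) H L s W v 0<s large = split (Any.any? (λ x → allBelow rich h x ≟ᵇ true) (W 0))
      where
      next : V → Family
      next x j = select (agree (H 0 (suc j)) ∘ G x) (W (suc j))
      rich : ℕ → V → Bool
      rich j x = length (W (suc j)) ≤ᵇ Λ * length (next x j)
      nonempty : 0 < length (W 0)
      nonempty with length (W 0) | large {0} (s≤s z≤n)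
      ... | zero  | le = contradiction (≤-trans 0<s (≤-trans le (≤-reflexive (*-zeroʳ L)))) λ ()
      ... | suc _ | _  = s≤s z≤n
      split : Dec (Any (λ x → allBelow rich h x ≡ true) (W 0)) → _
      split (yes any) with find any
      ... | x , x∈ , good with greedy h (λ i j → H (suc i) (suc j)) (L * Λ) s (next x) x 0<s large′
        where
        large′ : ∀ {i} → i < h → s ≤ L * Λ * length (next x i)
        large′ {i} i<h = ≤-trans (large (s≤s i<h)) (≤-trans
          (*-monoʳ-≤ L (≤ᵇ⇒≤ _ _ (≡true⇒T (allBelow-sound rich h good i<h)))) (≤-reflexive (sym (*-assoc L Λ _))))
      ... | inj₁ (f , f∈ , copy) = inj₁ (cons x f , (λ {i} → mem {i}) , λ {i} {j} → copy′ {i} {j})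
        where
        mem : ∀ {i} → i < suc h → cons x f i ∈ W i
        mem {zero}  _         = x∈
        mem {suc i} (s≤s i<h) = proj₁ (∈-select⁻ {p = agree (H 0 (suc i)) ∘ G x} (f∈ i<h))
        copy′ : Agrees (suc h) H (cons x f)
        copy′ {zero}  {suc j} _         (s≤s j<h) = agree⇒≡ {H 0 (suc j)}
            (proj₂ (∈-select⁻ {p = agree (H 0 (suc j)) ∘ G x} {xs = W (suc j)} (f∈ j<h)))
        copy′ {suc i} {suc j} (s≤s i<j) (s≤s j<h) = copy i<j j<h
      ... | inj₂ l = inj₂ record
        { X = X ; Y = Y ; dir = dir ; iX<iY = s≤s iX<iY ; iY<h = s≤s iY<h
        ; X⊆ = ⊆-trans X⊆ (select-⊆ (W _)) ; Y⊆ = ⊆-trans Y⊆ (select-⊆ (W _))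
        ; X-large = ≤-trans X-large (*-monoˡ-≤ (length X) le)
        ; Y-large = ≤-trans Y-large (*-monoˡ-≤ (length Y) le)
        ; few = few }
        where
        open Lopsided l
        le : loss Λ h * (L * Λ) ≤ loss Λ (suc h) * L
        le = ≤-trans (≤-reflexive (lemma (loss Λ h) L Λ)) (*-monoˡ-≤ L (m≤m+n (loss Λ h * Λ) (suc h)))
          where
          lemma : ∀ a b c → a * (b * c) ≡ a * c * b
          lemma = solve-∀
      split (no ¬any) with allBelow-pigeonhole rich (W 0) h nonempty
                             (λ x∈ → ¬-not λ e → ¬any (lose x∈ e))
      ... | j , j<h , le = inj₂ record
        { X = select (not ∘ rich j) (W 0) ; Y = W (suc j) ; dir = H 0 (suc j)
        ; iX<iY = s≤s z≤n ; iY<h = s≤s j<h ; X⊆ = select-⊆ (W 0) ; Y⊆ = ⊆-refl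
        ; X-large = ≤-trans (large (s≤s z≤n)) (≤-trans (*-monoʳ-≤ L
            (≤-trans le (≤-reflexive (cong (h *_) (sym (length-select (W 0)))))))
            (≤-trans (≤-reflexive (lemma L h _)) (*-monoˡ-≤ (length (select (not ∘ rich j) (W 0)))
                (*-monoˡ-≤ L h≤))))
        ; Y-large = ≤-trans (large (s≤s j<h)) (*-monoˡ-≤ (length (W (suc j)))
            (≤-trans (≤-reflexive (sym (*-identityˡ L))) (*-monoˡ-≤ L 1≤)))
        ; few = λ {x} x∈ → <⇒≤ (≰⇒> λ p → contradiction (trans
            (sym (cong not (Equivalence.to T-≡ (≤⇒≤ᵇ (p′ x p)))))
            (proj₂ (∈-select⁻ {p = not ∘ rich j} {xs = W 0} x∈))) λ ()) }
        where
        h≤ : h ≤ loss Λ (suc h)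
        h≤ = ≤-trans (n≤1+n h) (m≤n+m _ _)
        1≤ : 1 ≤ loss Λ (suc h)
        1≤ = ≤-trans (s≤s z≤n) (m≤n+m _ (loss Λ h * Λ))
        p′ : ∀ x → length (W (suc j)) ≤ Λ * count (agree (H 0 (suc j)) ∘ G x) (W (suc j)) → length (W (suc j)) ≤ Λ
            * length (next x j)
        p′ x = subst (λ c → length (W (suc j)) ≤ Λ * c) (sym (length-select (W (suc j))))
        lemma : ∀ a b c → a * (b * c) ≡ b * a * c
        lemma = solve-∀

  chunk : ℕ → List V → Family
  chunk m A i = take m (drop (i * m) A)

  chunk-⊆ : ∀ m A i → chunk m A i ⊆ A
  chunk-⊆ m A i = ⊆-trans (take-⊆ m (drop (i * m) A)) (drop-⊆ (i * m) A)

  length-chunk : ∀ m A i → suc i * m ≤ length A → length (chunk m A i) ≡ m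
  length-chunk m A i le = trans (length-take m _) (m≤n⇒m⊓n≡m
    (≤-trans (m+n≤o⇒m≤o∸n m le) (≤-reflexive (sym (length-drop (i * m) A)))))

  -- Chunks are consecutive segments, so a relation along the list passes to elements of different
  -- chunks. It is applied to `_≢_` and to the order of a chain.
  chunk-distinct : ∀ m {R : V → V → Set} {A i j} → AllPairs R A → i < j → ∀ {x y} →
                   x ∈ chunk m A i → y ∈ chunk m A j → R x y
  chunk-distinct m {R} {A} {i} {j} ps i<j {x} {y} x∈ y∈ =
    take-drop-related m (AllPairsₚ.drop⁺ (i * m) ps) x∈
      (subst (y ∈_) eq (⊆-lookup (⊆-trans (take-⊆ m _) (drop-⊆ (j * m ∸ suc i * m) (drop (suc i * m) A)))
          (subst (λ B → y ∈ take m B) (sym eq₂) y∈)))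
    where
    eq : drop (suc i * m) A ≡ drop m (drop (i * m) A)
    eq = trans (cong (λ z → drop z A) (+-comm m (i * m))) (sym (drop-drop (i * m) m A))
    eq₂ : drop (j * m ∸ suc i * m) (drop (suc i * m) A) ≡ drop (j * m) A
    eq₂ = trans (drop-drop (suc i * m) (j * m ∸ suc i * m) A) (cong (λ z → drop z A) (m+[n∸m]≡n (*-monoˡ-≤ m i<j)))

  record SparsePair (Λ K : ℕ) (A : List V) : Set where
    field
      X Y      : List V
      X⊆       : X ⊆ A
      Y⊆       : Y ⊆ A
      X-large  : length A ≤ K * length X
      Y-large  : length A ≤ K * length Y
      X-small  : length X < length A
      Y-small  : length Y < length A
      distinct : ∀ {x y} → x ∈ X → y ∈ Y → x ≢ y
      few      : Λ * pairs (λ x y → not (G x y)) X Y ≤ length X * length Y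

  -- `A` is cut into `h` chunks, in which `greedy` cannot embed `H`. Rounding at most halves a
  -- chunk, whence `2 * h`; `2 ≤ h` makes the chunks strictly shorter than `A`.
  sparsePair : ∀ h H Λ → 2 ≤ h → (¬ ∃ λ f → IsCopy h H f) → ∀ A → Unique A → h ≤ length A →
               SparsePair Λ (loss Λ h * (2 * h)) A
  sparsePair h@(suc _) H Λ 2≤h noCopy A@(v ∷ _) uniq h≤A
    with greedy Λ h H (2 * h) (length A) W v (s≤s z≤n) large
    where
    m = length A / h
    W = chunk m A
    large : ∀ {i} → i < h → length A ≤ 2 * h * length (W i)
    large {i} i<h = subst (λ z → length A ≤ 2 * h * z) (sym
        (length-chunk m A i (≤-trans (*-monoˡ-≤ m i<h) (≤-trans (≤-reflexive (*-comm h m))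
        (m/n*n≤m (length A) h))))) (begin
      length A               ≡⟨ m≡m%n+[m/n]*n (length A) h ⟩
      length A % h + m * h   ≤⟨ +-monoˡ-≤ (m * h) (<⇒≤ (m%n<n (length A) h)) ⟩
      h + m * h              ≡⟨⟩
      suc m * h              ≤⟨ *-monoˡ-≤ h (≤-trans (s≤s (m≤n+m m 0)) (+-monoˡ-≤ m 1≤m)) ⟩
      (m + m) * h            ≡⟨ lemma m h ⟩
      2 * h * m              ∎)
      where
      open ≤-Reasoning
      1≤m : 1 ≤ m
      1≤m = m≥n⇒m/n>0 h≤A
      lemma : ∀ m h → (m + m) * h ≡ 2 * h * m
      lemma = solve-∀
  ... | inj₁ (f , f∈ , copy) = contradiction (f , (λ {i} {j} → copy {i} {j}) , λ {i} {j} i<j j<h →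
      chunk-distinct (length A / h) {A = A} uniq i<j (f∈ {i} (<-trans i<j j<h)) (f∈ {j} j<h)) noCopy
  ... | inj₂ l = orient dir few
    where
    open Lopsided l
    m = length A / h
    1≤m : 1 ≤ m
    1≤m = m≥n⇒m/n>0 h≤A
    small : ∀ {Z i} → i < h → Z ⊆ chunk m A i → length Z < length A
    small {Z} {i} i<h s = begin-strict
      length Z                   ≤⟨ length-mono-≤ s ⟩
      length (chunk m A i)     ≡⟨ length-take m _ ⟩
      m ⊓ _                      ≤⟨ m⊓n≤m m _ ⟩
      m                          <⟨ +-monoˡ-≤ m 1≤m ⟩
      m + m                      ≡⟨ lemma m ⟩
      m * 2                      ≤⟨ *-monoʳ-≤ m 2≤h ⟩
      m * h                      ≤⟨ m/n*n≤m (length A) h ⟩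
      length A                   ∎
      where
      open ≤-Reasoning
      lemma : ∀ m → m + m ≡ m * 2
      lemma = solve-∀
    X-small = small (<-trans iX<iY iY<h) X⊆
    Y-small = small iY<h Y⊆
    X⊆A = ⊆-trans X⊆ (chunk-⊆ m A iX)
    Y⊆A = ⊆-trans Y⊆ (chunk-⊆ m A iY)
    distinct : ∀ {x y} → x ∈ X → y ∈ Y → x ≢ y
    distinct x∈ y∈ = chunk-distinct m {A = A} uniq iX<iY (⊆-lookup X⊆ x∈) (⊆-lookup Y⊆ y∈)
    -- `dir` tells which direction is rare; if it is the one from `X` to `Y`, the two sets change
    -- places.
    orient : ∀ d → (∀ {x} → x ∈ X → Λ * count (agree d ∘ G x) Y ≤ length Y) → SparsePair Λ (loss Λ h * (2 * h)) A
    orient false few = record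
      { X = X ; Y = Y ; X⊆ = X⊆A ; Y⊆ = Y⊆A ; X-large = X-large ; Y-large = Y-large
      ; X-small = X-small ; Y-small = Y-small ; distinct = distinct
      ; few = pairs-bound {R = λ x y → not (G x y)} {Λ} X Y few }
    orient true few = record
      { X = Y ; Y = X ; X⊆ = Y⊆A ; Y⊆ = X⊆A ; X-large = Y-large ; Y-large = X-large
      ; X-small = Y-small ; Y-small = X-small ; distinct = λ y∈ x∈ → distinct x∈ y∈ ∘ sym
      ; few = begin
          Λ * pairs (λ y x → not (G y x)) Y X ≡⟨ cong (Λ *_) (pairs-swap Y X) ⟩
          Λ * pairs (λ x y → not (G y x)) X Y ≤⟨ *-monoʳ-≤ Λ
              (pairs-cong X Y λ x∈ y∈ e → trans (total (distinct x∈ y∈)) e) ⟩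
          Λ * pairs G X Y                     ≤⟨ pairs-bound {R = G} {Λ} X Y few ⟩
          length X * length Y                 ≡⟨ *-comm (length X) _ ⟩
          length Y * length X                 ∎ }
      where open ≤-Reasoning

  Chain : List V → List V → Set
  Chain A ys = AllPairs _⟶_ ys × (∀ {y} → y ∈ ys → y ∈ A)

  -- The out- or the in-neighbourhood of the first vertex `x` has at least `2 ^ k` vertices; `x`
  -- goes in front of the chain found there in the first case and behind it in the second.
  log-chain : ∀ k A → Unique A → 2 ^ k ≤ length A → ∃ λ ys → Chain A ys × length ys ≡ suc k
  log-chain zero    (x ∷ A) _ _ = x ∷ [] , (([] ∷ []) , λ { (here refl) → here refl }) , refl
  log-chain (suc k) []      _ le = contradiction (m^n>0 2 (suc k)) (≤⇒≯ le)
  log-chain (suc k) (x ∷ A) (x∉A ∷ uniq) le with 2 ^ k ≤? length (select (G x) A) | 2 ^ k ≤? length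
      (select (not ∘ G x) A)
  ... | yes p | _     with log-chain k _ (AllPairs-resp-⊆ (select-⊆ A) uniq) p
  ...   | ys , (ch , ys⊆) , len = x ∷ ys , ((All.tabulate (λ y∈ → proj₂ (∈-select⁻ {xs = A} (ys⊆ y∈))) ∷ ch) , mem)
      , cong suc len
    where
    mem : ∀ {y} → y ∈ x ∷ ys → y ∈ x ∷ A
    mem (here e)   = here e
    mem (there y∈) = there (proj₁ (∈-select⁻ (ys⊆ y∈)))
  log-chain (suc k) (x ∷ A) (x∉A ∷ uniq) le | no _ | yes p with log-chain k _ (AllPairs-resp-⊆ (select-⊆ A) uniq) p
  ...   | ys , (ch , ys⊆) , len = ys ++ x ∷ [] ,
      (AllPairsₚ.++⁺ ch ([] ∷ []) (All.tabulate λ y∈ → into y∈ ∷ []) , mem) ,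
      trans (length-++ ys) (trans (+-comm _ 1) (cong suc len))
    where
    into : ∀ {y} → y ∈ ys → y ⟶ x
    into y∈ with ∈-select⁻ {p = not ∘ G x} {xs = A} (ys⊆ y∈)
    ... | y∈A , e = trans (total (All.lookup x∉A y∈A ∘ sym)) e
    mem : ∀ {y} → y ∈ ys ++ x ∷ [] → y ∈ x ∷ A
    mem y∈ with Anyₚ.++⁻ ys y∈
    ... | inj₁ y∈ys      = there (proj₁ (∈-select⁻ {p = not ∘ G x} (ys⊆ y∈ys)))
    ... | inj₂ (here e)  = here e
  log-chain (suc k) (x ∷ A) (x∉A ∷ uniq) le | no p | no q = contradiction le (<⇒≱ (begin-strict
    suc (length A)                         ≡⟨ cong suc (sym (count-not {p = G x} A)) ⟩
    suc (count (G x) A + count (not ∘ G x) A) ≡⟨ cong₂ (λ a b → suc (a + b)) (sym (length-select A))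
        (sym (length-select A)) ⟩
    suc (length (select (G x) A) + length (select (not ∘ G x) A)) <⟨ s≤s (≤-reflexive (sym (+-suc _ _))) ⟩
    suc (length (select (G x) A)) + suc (length (select (not ∘ G x) A)) ≤⟨ +-mono-≤ (≰⇒> p) (≰⇒> q) ⟩
    2 ^ k + 2 ^ k                          ≡⟨ cong (2 ^ k +_) (sym (+-identityʳ _)) ⟩
    2 ^ suc k                              ∎))
    where open ≤-Reasoning

-- Layouts

-- Powers of two, defined by doubling so that `power (suc r)` is literally the number `m + m` of
-- blocks that `double` produces.
power : ℕ → ℕ
power zero    = 1
power (suc r) = power r + power r

power≥1 : ∀ r → 1 ≤ power r
power≥1 zero    = ≤-refl
power≥1 (suc r) = ≤-trans (power≥1 r) (m≤m+n _ _)

m≤power : ∀ m → m ≤ power m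
m≤power zero    = z≤n
m≤power (suc m) = +-mono-≤ (power≥1 m) (m≤power m)

module Layouts {V : Set} (𝒯 : Tournament V) where
  open Core 𝒯

  record Blocks (m Λ K : ℕ) (A : List V) : Set where
    field
      W        : Family
      W⊆       : ∀ {i} → i < m → W i ⊆ A
      large    : ∀ {i} → i < m → length A ≤ K * length (W i)
      small    : 1 < m → ∀ {i} → i < m → length (W i) < length A
      distinct : ∀ {i j} → i < j → j < m → ∀ {x y} → x ∈ W i → y ∈ W j → x ≢ y
      few      : ∀ {i j} → i < j → j < m → Λ * pairs (λ x y → not (G x y)) (W i) (W j) ≤ length (W i) * length (W j)

  glue : ℕ → Family → Family → Family
  glue m W₁ W₂ i = if i <ᵇ m then W₁ i else W₂ (i ∸ m)

  glue-< : ∀ {m i} W₁ W₂ → i < m → glue m W₁ W₂ i ≡ W₁ i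
  glue-< W₁ W₂ i<m rewrite <ᵇ-true i<m = refl

  glue-≥ : ∀ {m i} W₁ W₂ → m ≤ i → glue m W₁ W₂ i ≡ W₂ (i ∸ m)
  glue-≥ W₁ W₂ m≤i rewrite <ᵇ-false m≤i = refl

  upper : ∀ {m i} → m ≤ i → i < m + m → i ∸ m < m
  upper {m} {i} m≤i i<2m = +-cancelˡ-< m _ _ (subst (_< m + m) (sym (m+[n∸m]≡n m≤i)) i<2m)

  -- A block inside `X` and one inside `Y` inherit the sparsity of the pair: shrinking both sides to
  -- a fraction `1 / suc K` raises the density by at most `suc K * suc K`, for which the hypothesis
  -- on `S` pays.
  double : ∀ {m Λ K K′ A} → 1 ≤ m → (S : SparsePair 𝒯 (Λ * (suc K * suc K)) K′ A) →
           Blocks m Λ (suc K) (SparsePair.X S) → Blocks m Λ (suc K) (SparsePair.Y S) →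
           Blocks (m + m) Λ (K′ * suc K) A
  double {m} {Λ} {K} {K′} {A} 1≤m S B₁ B₂ = record
    { W = glue m B₁.W B₂.W ; W⊆ = W⊆ ; large = large ; small = small ; distinct = distinct ; few = few }
    where
    module S = SparsePair S
    module B₁ = Blocks B₁
    module B₂ = Blocks B₂
    caseOn : ∀ {i} (P : List V → Set) → i < m + m → (i < m → P (B₁.W i)) → (m ≤ i → i ∸ m < m → P (B₂.W (i ∸ m))) →
             P (glue m B₁.W B₂.W i)
    caseOn {i} P i<2m f g with i <? m
    ... | yes i<m = subst P (sym (glue-< B₁.W B₂.W i<m)) (f i<m)
    ... | no  i≮m = subst P (sym (glue-≥ B₁.W B₂.W (≮⇒≥ i≮m))) (g (≮⇒≥ i≮m) (upper (≮⇒≥ i≮m) i<2m))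
    W⊆ : ∀ {i} → i < m + m → glue m B₁.W B₂.W i ⊆ A
    W⊆ i<2m = caseOn (_⊆ A) i<2m (λ i<m → ⊆-trans (B₁.W⊆ i<m) S.X⊆) (λ _ i<m → ⊆-trans (B₂.W⊆ i<m) S.Y⊆)
    large : ∀ {i} → i < m + m → length A ≤ K′ * suc K * length (glue m B₁.W B₂.W i)
    large i<2m = caseOn (λ Z → length A ≤ K′ * suc K * length Z) i<2m
      (λ i<m → trans≤ S.X-large (B₁.large i<m)) (λ _ i<m → trans≤ S.Y-large (B₂.large i<m))
      where
      trans≤ : ∀ {a b c} → a ≤ K′ * b → b ≤ suc K * c → a ≤ K′ * suc K * c
      trans≤ {c = c} p q = ≤-trans p (≤-trans (*-monoʳ-≤ K′ q) (≤-reflexive (sym (*-assoc K′ (suc K) c))))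
    small : 1 < m + m → ∀ {i} → i < m + m → length (glue m B₁.W B₂.W i) < length A
    small _ i<2m = caseOn (λ Z → length Z < length A) i<2m
      (λ i<m → ≤-<-trans (length-mono-≤ (B₁.W⊆ i<m)) S.X-small)
          (λ _ i<m → ≤-<-trans (length-mono-≤ (B₂.W⊆ i<m)) S.Y-small)
    distinct : ∀ {i j} → i < j → j < m + m → ∀ {x y} → x ∈ glue m B₁.W B₂.W i → y ∈ glue m B₁.W B₂.W j → x ≢ y
    distinct {i} {j} i<j j<2m {x} {y} = caseOn (λ Z → x ∈ Z → y ∈ glue m B₁.W B₂.W j → x ≢ y) (<-trans i<j j<2m)
      (λ i<m → λ x∈ → caseOn (λ Z → y ∈ Z → x ≢ y) j<2m
        (λ j<m → B₁.distinct i<j j<m x∈)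
        (λ _ j<m → λ y∈ → S.distinct (⊆-lookup (B₁.W⊆ i<m) x∈) (⊆-lookup (B₂.W⊆ j<m) y∈)))
      (λ m≤i i<m → λ x∈ → caseOn (λ Z → y ∈ Z → x ≢ y) j<2m
        (λ j<m → contradiction m≤i (<⇒≱ (<-trans i<j j<m)))
        (λ m≤j j<m → B₂.distinct (∸-monoˡ-< i<j m≤i) j<m x∈))
    Few : List V → List V → Set
    Few X Y = Λ * pairs (λ x y → not (G x y)) X Y ≤ length X * length Y
    few : ∀ {i j} → i < j → j < m + m → Few (glue m B₁.W B₂.W i) (glue m B₁.W B₂.W j)
    few {i} {j} i<j j<2m = caseOn (λ Z → Few Z (glue m B₁.W B₂.W j)) (<-trans i<j j<2m)
      (λ i<m → caseOn (Few (B₁.W i)) j<2m (λ j<m → B₁.few i<j j<m) (λ _ j<m → cross i<m j<m))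
      (λ m≤i i<m → caseOn (Few (B₂.W (i ∸ m))) j<2m
        (λ j<m → contradiction m≤i (<⇒≱ (<-trans i<j j<m)))
        (λ m≤j j<m → B₂.few (∸-monoˡ-< i<j m≤i) j<m))
      where
      cross : ∀ {i j} → i < m → j < m → Few (B₁.W i) (B₂.W j)
      cross {i} {j} i<m j<m = *-cancelˡ-≤ (suc K * suc K) (begin
        suc K * suc K * (Λ * p)                  ≡⟨ lemma₁ (suc K * suc K) Λ p ⟩
        Λ * (suc K * suc K) * p                  ≤⟨ *-monoʳ-≤ (Λ * (suc K * suc K))
            (pairs-⊆ (B₁.W⊆ i<m) (B₂.W⊆ j<m)) ⟩
        Λ * (suc K * suc K) * pairs (λ x y → not (G x y)) S.X S.Y ≤⟨ S.few ⟩
        length S.X * length S.Y                  ≤⟨ *-mono-≤ (B₁.large i<m) (B₂.large j<m) ⟩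
        suc K * a * (suc K * b)                  ≡⟨ lemma₂ (suc K) a b ⟩
        suc K * suc K * (a * b)                  ∎)
        where
        open ≤-Reasoning
        p = pairs (λ x y → not (G x y)) (B₁.W i) (B₂.W j)
        a = length (B₁.W i)
        b = length (B₂.W j)
        lemma₁ : ∀ a b c → a * (b * c) ≡ b * a * c
        lemma₁ = solve-∀
        lemma₂ : ∀ k a b → k * a * (k * b) ≡ k * k * (a * b)
        lemma₂ = solve-∀

  record SmoothBlocks (m M K : ℕ) (A : List V) : Set where
    field
      W        : Family
      W⊆       : ∀ {i} → i < m → W i ⊆ A
      large    : ∀ {i} → i < m → length A ≤ K * length (W i)
      small    : ∀ {i} → i < m → length (W i) < length A
      distinct : ∀ {i j} → i < m → j < m → i ≢ j → ∀ {x y} → x ∈ W i → y ∈ W j → x ≢ y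
      smooth   : Smooth M m W

  -- The first `m` of the `p` blocks are kept. `Blocks` bounds back edges for `i < j` only; the
  -- other order of the indices is obtained by transposing the count.
  smoothBlocks : ∀ {m p M K A} → m ≤ p → 1 < p → Blocks p (2 * m * (2 * M)) K A → SmoothBlocks m M (2 * K) A
  smoothBlocks {m} {p} {M} {K} {A} m≤p 1<p B with smoothing m M (Blocks.W B) sparse
    where
    module B = Blocks B
    sparse : Sparse (2 * m * (2 * M)) m B.W
    sparse {i} {j} i<m j<m i≢j with <-cmp i j
    ... | tri< i<j _ _ = ≤-trans (*-monoʳ-≤ (2 * m * (2 * M))
        (pairs-cong (B.W i) (B.W j) λ _ _ e → trans (cong not (sym (fw-< i<j))) e)) (B.few i<j (≤-trans j<m m≤p))
    ... | tri≈ _ i≡j _ = contradiction i≡j i≢j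
    ... | tri> _ _ j<i = ≤-trans (*-monoʳ-≤ (2 * m * (2 * M)) (≤-trans (≤-reflexive (pairs-swap (B.W i) (B.W j)))
            (pairs-cong (B.W j) (B.W i) λ {x} {y} _ _ e → trans (cong not (sym (fw-> j<i))) e)))
            (≤-trans (B.few j<i (≤-trans i<m m≤p)) (≤-reflexive (*-comm (length (B.W j)) _)))
  ... | W , W⊆ , half , smooth = record
    { W = W ; W⊆ = λ i<m → ⊆-trans (W⊆ _) (B.W⊆ (≤-trans i<m m≤p))
    ; large = λ i<m → ≤-trans (B.large (≤-trans i<m m≤p))
        (≤-trans (*-monoʳ-≤ K (half i<m)) (≤-reflexive (lemma K _)))
    ; small = λ i<m → ≤-<-trans (length-mono-≤ (W⊆ _)) (B.small 1<p (≤-trans i<m m≤p))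
    ; distinct = distinct ; smooth = smooth }
    where
    module B = Blocks B
    lemma : ∀ k l → k * (2 * l) ≡ 2 * k * l
    lemma = solve-∀
    distinct : ∀ {i j} → i < m → j < m → i ≢ j → ∀ {x y} → x ∈ W i → y ∈ W j → x ≢ y
    distinct {i} {j} i<m j<m i≢j x∈ y∈ with <-cmp i j
    ... | tri< i<j _ _ = B.distinct i<j (≤-trans j<m m≤p) (⊆-lookup (W⊆ i) x∈) (⊆-lookup (W⊆ j) y∈)
    ... | tri≈ _ i≡j _ = contradiction i≡j i≢j
    ... | tri> _ _ j<i = B.distinct j<i (≤-trans i<m m≤p) (⊆-lookup (W⊆ j) y∈) (⊆-lookup (W⊆ i) x∈) ∘ sym

  -- `W 2` is listed in chain order, so it lies in `A` only as a set; hence the exception in `W⊆`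
  -- and the separate `W∈`. `d` is the length of the chain before the last smoothing, which keeps at
  -- least half of it.
  record Layout (m M K q : ℕ) (A : List V) : Set where
    field
      W        : Family
      W⊆       : ∀ {i} → i < m → i ≢ 2 → W i ⊆ A
      W∈       : ∀ {i} → i < m → ∀ {x} → x ∈ W i → x ∈ A
      large    : ∀ {i} → i < m → i ≢ 2 → length A ≤ K * length (W i)
      small    : ∀ {i} → i < m → i ≢ 2 → length (W i) < length A
      chain    : AllPairs _⟶_ (W 2)
      d        : ℕ
      d-large  : length A ≤ K * d ^ q
      d≤       : d ≤ 2 * length (W 2)
      6≤d      : 6 ≤ d
      distinct : ∀ {i j} → i < m → j < m → i ≢ j → ∀ {x y} → x ∈ W i → y ∈ W j → x ≢ y
      smooth   : Smooth M m W

  replace : List V → Family → Family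
  replace D W i with i ≟ 2
  ... | yes _ = D
  ... | no _  = W i

  replace-≢ : ∀ {D W i} → i ≢ 2 → replace D W i ≡ W i
  replace-≢ {i = i} i≢2 with i ≟ 2
  ... | yes i≡2 = contradiction i≡2 i≢2
  ... | no _    = refl

  replace-∈ : ∀ {D W} → (∀ {y} → y ∈ D → y ∈ W 2) → ∀ {i x} → x ∈ replace D W i → x ∈ W i
  replace-∈ D⊆ {i} x∈ with i ≟ 2
  ... | yes refl = D⊆ x∈
  ... | no _     = x∈

  -- The chain may be sparse in the middle set; so smoothness
  -- has to be restored by a second round of deletions.
  insertChain : ∀ {m M K q A D} → 2 < m → (B : SmoothBlocks m (2 * m * (2 * M)) K A) → Chain 𝒯 (SmoothBlocks.W B 2)
      D →
                length (SmoothBlocks.W B 2) ≤ length D ^ q → 6 ≤ length D → Layout m M (2 * K) q A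
  insertChain {m} {M} {K} {q} {A} {D} 2<m B (D-chain , D⊆) D-long 6≤D with smoothing m M
      (replace D (SmoothBlocks.W B)) sparse
    where
    open SmoothBlocks B
    Λ = 2 * m * (2 * M)
    W′ = replace D W
    bound : ∀ {i j} → i < m → j < m → i ≢ j → j ≢ 2 → Λ * pairs (back i j) (W′ i) (W′ j) ≤ length (W′ i) * length
        (W′ j)
    bound {i} {j} i<m j<m i≢j j≢2 = pairs-bound {R = back i j} {Λ} (W′ i) (W′ j)
      λ {x} x∈ → subst (λ Z → Λ * count (back i j x) Z ≤ length Z) (sym (replace-≢ {D} {W} j≢2))
          (smooth i<m j<m i≢j (replace-∈ {D} {W} D⊆ {i} x∈))
    sparse : Sparse Λ m W′
    sparse {i} {j} i<m j<m i≢j = caseOf (j ≟ 2)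
      where
      caseOf : Dec (j ≡ 2) → Λ * pairs (back i j) (W′ i) (W′ j) ≤ length (W′ i) * length (W′ j)
      caseOf (no j≢2) = bound i<m j<m i≢j j≢2
      -- A vertex of `W′ i` may have many back edges to the chain, but a vertex of the chain has few
      -- to `W′ i`, so the count is made from the side of the chain.
      caseOf (yes refl) = begin
        Λ * pairs (back i 2) (W′ i) (W′ 2)                ≡⟨ cong (Λ *_) (pairs-swap (W′ i) (W′ 2)) ⟩
        Λ * pairs (λ y x → back i 2 x y) (W′ 2) (W′ i)   
            ≤⟨ *-monoʳ-≤ Λ (pairs-cong (W′ 2) (W′ i) λ {y} {x} _ _ e → trans (cong not (fw-sym (i≢j ∘ sym) y x)) e)
            ⟩
        Λ * pairs (back 2 i) (W′ 2) (W′ i)                ≤⟨ bound j<m i<m (i≢j ∘ sym) i≢j ⟩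
        length (W′ 2) * length (W′ i)                      ≡⟨ *-comm (length (W′ 2)) _ ⟩
        length (W′ i) * length (W′ 2)                      ∎
        where open ≤-Reasoning
  ... | W₃ , W₃⊆ , half , smooth₃ = record
    { W = W₃ ; W⊆ = λ i<m i≢2 → ⊆-trans (W₃⊆W i≢2) (W⊆ i<m)
    ; W∈ = λ i<m x∈ → ⊆-lookup (W⊆ i<m) (W₃∈ x∈)
    ; large = λ i<m i≢2 → ≤-trans (large i<m) (≤-trans (*-monoʳ-≤ K
        (subst (λ Z → length Z ≤ 2 * length (W₃ _)) (replace-≢ i≢2) (half i<m)))
        (≤-reflexive (lemma K _)))
    ; small = λ i<m i≢2 → ≤-<-trans (length-mono-≤ (W₃⊆W i≢2)) (small i<m)
    ; chain = AllPairs-resp-⊆ (W₃⊆ 2) D-chain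
    ; d = length D ; d-large = ≤-trans (large 2<m) (≤-trans (*-monoʳ-≤ K D-long)
        (*-monoˡ-≤ (length D ^ q) (m≤m+n K (K + 0))))
    ; d≤ = half 2<m ; 6≤d = 6≤D
    ; distinct = λ i<m j<m i≢j x∈ y∈ → distinct i<m j<m i≢j (W₃∈ x∈) (W₃∈ y∈) ; smooth = smooth₃ }
    where
    open SmoothBlocks B
    lemma : ∀ k l → k * (2 * l) ≡ 2 * k * l
    lemma = solve-∀
    W₃⊆W : ∀ {i} → i ≢ 2 → W₃ i ⊆ W i
    W₃⊆W {i} i≢2 = subst (W₃ i ⊆_) (replace-≢ i≢2) (W₃⊆ i)
    W₃∈ : ∀ {i x} → x ∈ W₃ i → x ∈ W i
    W₃∈ {i} x∈ = replace-∈ {D} {W} D⊆ {i} (⊆-lookup (W₃⊆ i) x∈)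

  HasChains : ℕ → List V → Set
  HasChains q A = ∀ B → Unique B → length B < length A → ∃ λ ys → Chain 𝒯 B ys × length B ≤ length ys ^ q

  -- If the chain given by the hypothesis has fewer than six vertices, the six that `log-chain`
  -- finds among 32 replace it, and the bound only improves.
  long-chain : ∀ {q A} B → Unique B → 2 ^ 5 ≤ length B → length B < length A → HasChains q A →
               ∃ λ D → Chain 𝒯 B D × length B ≤ length D ^ q × 6 ≤ length D
  long-chain {q} B uniq 32≤ B<A chains with chains B uniq B<A
  ... | ys , ch , le with 6 ≤? length ys
  ...   | yes 6≤ = ys , ch , le , 6≤
  ...   | no 6≰ with log-chain 𝒯 5 B uniq 32≤
  ...     | zs , ch′ , len = zs , ch′ ,
    ≤-trans le (^-monoˡ-≤ q (subst (length ys ≤_) (sym len) (<⇒≤ (≰⇒> 6≰)))) , ≤-reflexive (sym len)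

  -- The nested factors pay for two smoothings, before and after the chain is inserted;
  -- `2 * K * 2 ^ 5` leaves at least 32 vertices in `W 2` after the first.
  makeLayout : ∀ {m M q K N} → 2 < m → m ≤ power m → .{{_ : NonZero K}} →
               (∀ A → Unique A → N ≤ length A → Blocks (power m) (2 * m * (2 * (2 * m * (2 * M)))) K A) →
               ∀ A → Unique A → N + 2 * K * 2 ^ 5 ≤ length A → HasChains q A → Layout m M (2 * (2 * K)) q A
  makeLayout {m} {M} {q} {K} {N} 2<m m≤ mkBlocks A uniq N≤ chains = finish smoothed
    where
    smoothed : SmoothBlocks m (2 * m * (2 * M)) (2 * K) A
    smoothed = smoothBlocks m≤ (≤-trans (<⇒≤ 2<m) m≤) (mkBlocks A uniq (m+n≤o⇒m≤o N N≤))
    enough : ∀ {l} → length A ≤ 2 * K * l → 2 ^ 5 ≤ l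
    enough {l} le = *-cancelˡ-≤ {2 ^ 5} {l} (2 * K) {{m*n≢0 2 K}} (≤-trans (m+n≤o⇒n≤o N N≤) le)
    finish : SmoothBlocks m (2 * m * (2 * M)) (2 * K) A → Layout m M (2 * (2 * K)) q A
    finish B with long-chain {q} {A} (SmoothBlocks.W B 2) (AllPairs-resp-⊆ (SmoothBlocks.W⊆ B 2<m) uniq)
                    (enough (SmoothBlocks.large B 2<m)) (SmoothBlocks.small B 2<m) chains
    ... | D , ch , le , 6≤ = insertChain 2<m B ch le 6≤

-- K and N must not depend on the tournament.
blocks : ∀ h → 2 ≤ h → ∀ r Λ → ∃₂ λ K N → ∀ {V : Set} (𝒯 : Tournament V) H → (¬ ∃ λ f → IsCopy 𝒯 h H f) →
         ∀ A → Unique A → N ≤ length A → Layouts.Blocks 𝒯 (power r) Λ (suc K) A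
blocks h 2≤h zero    Λ = 0 , 0 , λ 𝒯 H noCopy A uniq N≤ → record
  { W = λ _ → A ; W⊆ = λ _ → ⊆-refl ; large = λ _ → ≤-reflexive (sym (*-identityˡ _))
  ; small = λ { (s≤s ()) } ; distinct = λ { i<j (s≤s z≤n) → contradiction i<j λ () } ; few = λ { i<j (s≤s z≤n) →
      contradiction i<j λ () } }
blocks h 2≤h (suc r) Λ with blocks h 2≤h r Λ
-- The threshold allows `A` to be cut into `h` chunks and leaves `N` vertices on both sides of the
-- pair; `pred` is undone by the `suc` in the statement.
... | K , N , rec = pred (suc K′ * suc K) , h + suc K′ * N , split
  where
  K′ = loss (Λ * (suc K * suc K)) h * (2 * h)
  split : ∀ {V : Set} (𝒯 : Tournament V) H → (¬ ∃ λ f → IsCopy 𝒯 h H f) → ∀ A → Unique A → h + suc K′ * N ≤ length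
      A →
          Layouts.Blocks 𝒯 (power r + power r) Λ (suc K′ * suc K) A
  split {V} 𝒯 H noCopy A uniq N≤ = Layouts.double 𝒯 (power≥1 r) S
    (rec 𝒯 H noCopy S.X (AllPairs-resp-⊆ S.X⊆ uniq) (enough S.X-large))
    (rec 𝒯 H noCopy S.Y (AllPairs-resp-⊆ S.Y⊆ uniq) (enough S.Y-large))
    where
    S₀ = sparsePair 𝒯 h H (Λ * (suc K * suc K)) 2≤h noCopy A uniq (m+n≤o⇒m≤o h N≤)
    module S₀ = SparsePair S₀
    S : SparsePair 𝒯 (Λ * (suc K * suc K)) (suc K′) A
    S = record { S₀ ; X-large = ≤-trans S₀.X-large (m≤n+m _ _) ; Y-large = ≤-trans S₀.Y-large (m≤n+m _ _) }
    module S = SparsePair S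
    enough : ∀ {l} → length A ≤ suc K′ * l → N ≤ l
    enough le = *-cancelˡ-≤ (suc K′) (≤-trans (m≤n+m _ h) (≤-trans N≤ le))

layout : ∀ h → 2 ≤ h → ∀ m M → 2 < m → ∃₂ λ K N → ∀ {V : Set} (𝒯 : Tournament V) H → (¬ ∃ λ f → IsCopy 𝒯 h H f) →
         ∀ q A → Unique A → N ≤ length A → Layouts.HasChains 𝒯 q A → Layouts.Layout 𝒯 m M K q A
layout h 2≤h m M 2<m =
  let K , N , mkBlocks = blocks h 2≤h m (2 * m * (2 * (2 * m * (2 * M)))) in
  2 * (2 * suc K) , N + 2 * suc K * 2 ^ 5 , λ 𝒯 H noCopy q → Layouts.makeLayout 𝒯 2<m (m≤power m)
      (mkBlocks 𝒯 H noCopy)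

-- Finding a C₅-chain in a layout

module Configurations {V : Set} (𝒯 : Tournament V) where
  open Core 𝒯

  record C5 (s₁ s₂ s₃ s₄ s₅ : V) : Set where
    field
      e₁₂ : s₁ ⟶ s₂
      e₁₃ : s₁ ⟶ s₃
      e₂₃ : s₂ ⟶ s₃
      e₂₄ : s₂ ⟶ s₄
      e₃₄ : s₃ ⟶ s₄
      e₃₅ : s₃ ⟶ s₅
      e₄₅ : s₄ ⟶ s₅
      e₄₁ : s₄ ⟶ s₁
      e₅₁ : s₅ ⟶ s₁
      e₅₂ : s₅ ⟶ s₂

  -- `r` is `h₆` and dominates `s₃` alone. In a `C5` each vertex dominates the next two in cyclic
  -- order, so rotations are symmetries, and any `r` dominating exactly one vertex of a C₅ fits
  -- after a rotation.
  record C5+ (s₁ s₂ s₃ s₄ s₅ r : V) : Set where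
    field
      c5  : C5 s₁ s₂ s₃ s₄ s₅
      e₁  : s₁ ⟶ r
      e₂  : s₂ ⟶ r
      e₃  : r ⟶ s₃
      e₄  : s₄ ⟶ r
      e₅  : s₅ ⟶ r

  -- Reversing the pairs p₂ᵢ₋₁, p₂ᵢ turns P into the transitive tournament p₂, p₁, p₄, p₃, …; in this
  -- order the second vertex is the only one that dominates h₆.
  record Config (k : ℕ) : Set where
    field
      {s₁ s₂ s₃ s₄ s₅ r q₁ q₂} : V
      qs    : List V
      c5+   : C5+ s₁ s₂ s₃ s₄ s₅ r
      chain : AllPairs _⟶_ (q₁ ∷ q₂ ∷ qs)
      s⟶q   : All (λ q → All (_⟶ q) (s₁ ∷ s₂ ∷ s₃ ∷ s₄ ∷ s₅ ∷ [])) (q₁ ∷ q₂ ∷ qs)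
      r⟶q₁  : r ⟶ q₁
      q₂⟶r  : q₂ ⟶ r
      r⟶qs  : All (r ⟶_) qs
      long  : k ≤ length qs

  Placed : Family → ℕ × V → Set
  Placed W (i , x) = i < 9 × x ∈ W i

  fwd : List (ℕ × V) → ℕ → V → Bool
  fwd []            j y = true
  fwd ((i , x) ∷ F) j y = fw i j x y ∧ fwd F j y

  Forward : List (ℕ × V) → ℕ → V → Set
  Forward F j y = All (λ (i , x) → fw i j x y ≡ true) F

  fwd-Forward : ∀ F j y → fwd F j y ≡ true → Forward F j y
  fwd-Forward []      j y h = []
  fwd-Forward (_ ∷ F) j y h = proj₁ (∧-true h) ∷ fwd-Forward F j y (proj₂ (∧-true h))

  -- In the order of the sets, W 0, …, W 4 are for a, b, y (also m and z), c and w; W 5 is for q₂, W 6 for r,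
  -- W 7 for q₁ and W 8 for qs.
  module Find (t : ℕ) (noConfig : ¬ Config (2 * t)) (W : Family)
              (smooth : Smooth 128 9 W)
              (distinct : ∀ {i j} → i < 9 → j < 9 → i ≢ j → ∀ {x y} → x ∈ W i → y ∈ W j → x ≢ y)
              (chain : AllPairs _⟶_ (W 2)) (3≤D : 3 ≤ length (W 2))
              (uniq : Unique (W 8)) (long : 2 * 2 ^ (2 * t) ≤ length (W 8))
              (backEdge : ∀ {i j} → i < j → j < 9 → ∀ {X Y} → X ⊆ W i → Y ⊆ W j →
                 length (W i) ≤ 16 * length X → length (W j) ≤ 16 * length Y →
                 ∃₂ λ x y → x ∈ X × y ∈ Y × y ⟶ x) where

    restrict : List (ℕ × V) → ℕ → List V → List V
    restrict F j = select (fwd F j)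

    private variable
      F : List (ℕ × V)
      i j : ℕ
      X Y : List V

    count-not-fwd : All (Placed W) F → All (λ p → proj₁ p ≢ j) F → j < 9 → X ⊆ W j →
                    128 * count (not ∘ fwd F j) X ≤ length F * length (W j)
    count-not-fwd {X = X} []        []        j<9 X⊆ = ≤-reflexive
        (trans (cong (128 *_) (count-none X λ _ ())) (*-zeroʳ 128))
    count-not-fwd {(i , x) ∷ F} {j} {X} ((i<9 , x∈) ∷ pl) (i≢j ∷ av) j<9 X⊆ = begin
      128 * count (not ∘ fwd ((i , x) ∷ F) j) X
        ≤⟨ *-monoʳ-≤ 128 (≤-trans (count-mono X λ {y} _ → deMorgan (fw i j x y) (fwd F j y)) (count-∨ X)) ⟩
      128 * (count (back i j x) X + count (not ∘ fwd F j) X)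
        ≡⟨ *-distribˡ-+ 128 (count (back i j x) X) (count (not ∘ fwd F j) X) ⟩
      128 * count (back i j x) X + 128 * count (not ∘ fwd F j) X
        ≤⟨ +-mono-≤ (≤-trans (*-monoʳ-≤ 128 (count-⊆ X⊆)) (smooth i<9 j<9 i≢j x∈)) (count-not-fwd pl av j<9 X⊆) ⟩
      length (W j) + length F * length (W j) ∎
      where
      open ≤-Reasoning

    -- Each vertex of `F` spoils at most `1 / 128` of `W j`. As `a * length F ≤ 64`, this amounts to
    -- at most `length (W j) / (2 * a)`, hence to at most half of `X`.
    restrict-large : ∀ {a} → a * length F ≤ 64 → All (Placed W) F → All (λ p → proj₁ p ≢ j) F → j < 9 → X ⊆ W j →
                     length (W j) ≤ a * length X → length (W j) ≤ 2 * a * length (restrict F j X)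
    restrict-large {F} {j} {X} {a} aF≤64 pl av j<9 X⊆ le = *-cancelˡ-≤ 64 (+-cancelʳ-≤ (64 * w) _ _ (begin
      64 * w + 64 * w                      ≡⟨ lemma₁ w ⟩
      128 * w                              ≤⟨ *-monoʳ-≤ 128 le ⟩
      128 * (a * length X)                 ≡⟨ cong (λ l → 128 * (a * l)) (sym (count-not {p = fwd F j} X)) ⟩
      128 * (a * (count (fwd F j) X + n))  ≡⟨ lemma₂ a (count (fwd F j) X) n ⟩
      64 * (2 * a * count (fwd F j) X) + a * (128 * n)
        ≤⟨ +-mono-≤ (≤-reflexive (cong (λ l → 64 * (2 * a * l)) (sym (length-select X))))
            (≤-trans (*-monoʳ-≤ a (count-not-fwd pl av j<9 X⊆))
             (≤-trans (≤-reflexive (sym (*-assoc a (length F) w))) (*-monoˡ-≤ w aF≤64))) ⟩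
      64 * (2 * a * length (restrict F j X)) + 64 * w ∎))
      where
      open ≤-Reasoning
      w = length (W j)
      n = count (not ∘ fwd F j) X
      lemma₁ : ∀ w → 64 * w + 64 * w ≡ 128 * w
      lemma₁ = solve-∀
      lemma₂ : ∀ a g n → 128 * (a * (g + n)) ≡ 64 * (2 * a * g) + a * (128 * n)
      lemma₂ = solve-∀

    restrict-all-large : length F ≤ 64 → All (Placed W) F → All (λ p → proj₁ p ≢ j) F → j < 9 →
                         length (W j) ≤ 2 * length (restrict F j (W j))
    restrict-all-large {F} F≤64 pl av j<9 = restrict-large {a = 1}
        (≤-trans (≤-reflexive (*-identityˡ (length F))) F≤64) pl av j<9 ⊆-refl
      (≤-reflexive (sym (*-identityˡ _)))

    relax : ∀ {a w} (X : List V) → a ≤ 16 → w ≤ a * length X → w ≤ 16 * length X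
    relax X a≤16 le = ≤-trans le (*-monoˡ-≤ (length X) a≤16)

    not≡true⇒≡false : ∀ {b} → not b ≡ true → b ≡ false
    not≡true⇒≡false {false} _ = refl

    backPair : i ≢ j → i < 9 → j < 9 → X ⊆ W i → Y ⊆ W j →
               length (W i) ≤ 16 * length X → length (W j) ≤ 16 * length Y →
               ∃₂ λ x y → x ∈ X × y ∈ Y × back i j x y ≡ true
    backPair {i} {j} i≢j i<9 j<9 X⊆ Y⊆ lX lY with <-cmp i j
    ... | tri≈ _ i≡j _ = contradiction i≡j i≢j
    ... | tri< i<j _ _ = let x , y , x∈ , y∈ , e = backEdge i<j j<9 X⊆ Y⊆ lX lY in
          x , y , x∈ , y∈ , cong not (trans (fw-< i<j) (⟶-asym e))
    ... | tri> _ _ j<i = let y , x , y∈ , x∈ , e = backEdge j<i i<9 Y⊆ X⊆ lY lX in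
          x , y , x∈ , y∈ , cong not (trans (fw-> j<i) (⟶-asym e))

    hit? : ∀ i j (Y : List V) x → Dec (Any (λ y → back i j x y ≡ true) Y)
    hit? i j Y x = Any.any? (λ y → back i j x y ≟ᵇ true) Y

    hitting : ℕ → ℕ → List V → List V → List V
    hitting i j X Y = select (λ x → does (hit? i j Y x)) X

    hitting⁻ : ∀ {x} → x ∈ hitting i j X Y → x ∈ X × ∃ λ y → y ∈ Y × back i j x y ≡ true
    hitting⁻ {i} {j} {X} {Y} {x} x∈ with ∈-select⁻ {xs = X} x∈
    ... | x∈X , e with hit? i j Y x
    ...   | yes any = x∈X , find any

    -- The vertices of `X` without a back edge into `Y` make up less than `1 / 16` of `W i`, since
    -- `backPair` would find a back edge at one of them. `X` is at least half of `W i`, so `7 / 16`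
    -- remain.
    hitting-large : i ≢ j → i < 9 → j < 9 → X ⊆ W i → Y ⊆ W j →
                    length (W i) ≤ 2 * length X → length (W j) ≤ 16 * length Y →
                    length (W i) ≤ 16 * length (hitting i j X Y)
    hitting-large {i} {j} {X} {Y} i≢j i<9 j<9 X⊆ Y⊆ lX lY = finish (length (W i) ≤? 16 * length missing)
      where
      h : V → Bool
      h x = does (hit? i j Y x)
      missing = select (not ∘ h) X
      finish : Dec (length (W i) ≤ 16 * length missing) → length (W i) ≤ 16 * length (hitting i j X Y)
      finish (yes le) with backPair i≢j i<9 j<9 (⊆-trans (select-⊆ X) X⊆) Y⊆ le lY
      ... | x , y , x∈ , y∈ , e with ∈-select⁻ {xs = X} x∈
      ...   | _ , nh with hit? i j Y x
      ...     | no ¬any = contradiction (lose y∈ e) ¬any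
      finish (no ≰) = *-cancelˡ-≤ 14 (+-cancelʳ-≤ (2 * w) _ _ (begin
        14 * w + 2 * w                     ≡⟨ lemma₁ w ⟩
        16 * w                             ≤⟨ *-monoʳ-≤ 16 lX ⟩
        16 * (2 * length X)                ≡⟨ cong (λ l → 16 * (2 * l)) (sym (count-not {p = h} X)) ⟩
        16 * (2 * (count h X + count (not ∘ h) X)) ≡⟨ lemma₂ (count h X) _ ⟩
        32 * count h X + 2 * (16 * count (not ∘ h) X) ≤⟨ +-mono-≤ (*-monoˡ-≤ (count h X) (m≤m+n 32 192))
            (*-monoʳ-≤ 2 (≤-trans (≤-reflexive (cong (16 *_) (sym (length-select X)))) (<⇒≤ (≰⇒> ≰)))) ⟩
        224 * count h X + 2 * w            ≡⟨ cong (λ l → l + 2 * w)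
            (trans (*-assoc 14 16 (count h X)) (cong (λ l → 14 * (16 * l)) (sym (length-select X)))) ⟩
        14 * (16 * length (hitting i j X Y)) + 2 * w ∎))
        where
        open ≤-Reasoning
        w = length (W i)
        lemma₁ : ∀ w → 14 * w + 2 * w ≡ 16 * w
        lemma₁ = solve-∀
        lemma₂ : ∀ a b → 16 * (2 * (a + b)) ≡ 32 * a + 2 * (16 * b)
        lemma₂ = solve-∀

    6<9 : 6 < 9
    6<9 = m≤m+n 7 2

    Left : V → Set
    Left x = ∃ λ i → i < 5 × x ∈ W i

    -- The rest of a `Config` is always available. Among the vertices forward with respect to the
    -- six given ones, a back edge from `W 7` to `W 5` supplies `q₁` and `q₂`; `W 6` lies between,
    -- so `q₂ ⟶ r ⟶ q₁`. Then `log-chain` finds `qs` in `W 8`.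
    no-C5+ : ∀ {s₁ s₂ s₃ s₄ s₅ r} → Left s₁ → Left s₂ → Left s₃ → Left s₄ → Left s₅ → r ∈ W 6 →
             C5+ s₁ s₂ s₃ s₄ s₅ r → ⊥
    no-C5+ {s₁} {s₂} {s₃} {s₄} {s₅} {r} (i₁ , l₁ , ∈₁) (i₂ , l₂ , ∈₂) (i₃ , l₃ , ∈₃) (i₄ , l₄ , ∈₄) (i₅ , l₅ , ∈₅)
        r∈ c5+
      = withPair (backEdge (m≤m+n 6 1) (m≤m+n 8 1) (select-⊆ (W 5)) (select-⊆ (W 7))
          (relax P₁ (m≤m+n 2 14) (restrict-all-large {F₆} (m≤m+n 6 58) placed
              (avoid {5} (m≤m+n 5 0) (λ ())) (m≤m+n 6 3)))
          (relax P₂ (m≤m+n 2 14) (restrict-all-large {F₆} (m≤m+n 6 58) placed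
              (avoid {7} (m≤m+n 5 2) (λ ())) (m≤m+n 8 1))))
      where
      S F₆ : List (ℕ × V)
      S  = (i₁ , s₁) ∷ (i₂ , s₂) ∷ (i₃ , s₃) ∷ (i₄ , s₄) ∷ (i₅ , s₅) ∷ []
      F₆ = (6 , r) ∷ S
      <9 : ∀ {i} → i < 5 → i < 9
      <9 i<5 = ≤-trans i<5 (m≤m+n 5 4)
      placed : All (Placed W) F₆
      placed = (6<9 , r∈) ∷ (<9 l₁ , ∈₁) ∷ (<9 l₂ , ∈₂) ∷ (<9 l₃ , ∈₃) ∷ (<9 l₄ , ∈₄) ∷ (<9 l₅ , ∈₅) ∷ []
      avoid : ∀ {j} → 5 ≤ j → 6 ≢ j → All (λ p → proj₁ p ≢ j) F₆
      avoid {j} 5≤j 6≢j = 6≢j ∷ left l₁ ∷ left l₂ ∷ left l₃ ∷ left l₄ ∷ left l₅ ∷ []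
        where
        left : ∀ {i} → i < 5 → i ≢ j
        left i<5 refl = <⇒≱ i<5 5≤j
      dominated : ∀ j {q} → 5 ≤ j → Forward S j q → All (_⟶ q) (s₁ ∷ s₂ ∷ s₃ ∷ s₄ ∷ s₅ ∷ [])
      dominated j {q} 5≤j (f₁ ∷ f₂ ∷ f₃ ∷ f₄ ∷ f₅ ∷ []) = use l₁ f₁ ∷ use l₂ f₂ ∷ use l₃ f₃ ∷ use l₄ f₄ ∷ use l₅
          f₅ ∷ []
        where
        use : ∀ {i x} → i < 5 → fw i j x q ≡ true → x ⟶ q
        use i<5 f = trans (sym (fw-< (≤-trans i<5 5≤j))) f
      P₁ = restrict F₆ 5 (W 5)
      P₂ = restrict F₆ 7 (W 7)
      withPair : (∃₂ λ x y → x ∈ P₁ × y ∈ P₂ × y ⟶ x) → ⊥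
      withPair (p₁ , p₂ , p₁∈ , p₂∈ , p₂⟶p₁) with ∈-select⁻ {xs = W 5} p₁∈ | ∈-select⁻ {xs = W 7} p₂∈
      ... | p₁∈W , f₁ | p₂∈W , f₂ with fwd-Forward F₆ 5 p₁ f₁ | fwd-Forward F₆ 7 p₂ f₂
      ...   | p₁⟶r ∷ fS₁ | r⟶p₂ ∷ fS₂ = withChain (log-chain 𝒯 (2 * t) Z (AllPairs-resp-⊆ (select-⊆ (W 8)) uniq)
                (*-cancelˡ-≤ 2 (≤-trans long (restrict-all-large {F₈} (m≤m+n 8 56) placed₈ avoid₈ ≤-refl))))
        where
        F₈ = (5 , p₁) ∷ (7 , p₂) ∷ F₆
        Z = restrict F₈ 8 (W 8)
        placed₈ : All (Placed W) F₈
        placed₈ = (m≤m+n 6 3 , p₁∈W) ∷ (m≤m+n 8 1 , p₂∈W) ∷ placed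
        avoid₈ : All (λ p → proj₁ p ≢ 8) F₈
        avoid₈ = (λ ()) ∷ (λ ()) ∷ avoid (m≤m+n 5 3) (λ ())
        withChain : (∃ λ qs → Chain 𝒯 Z qs × length qs ≡ suc (2 * t)) → ⊥
        withChain (qs , (qs-chain , qs⊆) , len) = noConfig record
          { qs = qs ; c5+ = c5+
          ; chain = (p₂⟶p₁ ∷ All.tabulate (λ q∈ → proj₁ (proj₂ (onZ (qs⊆ q∈))))) ∷ All.tabulate
              (λ q∈ → proj₁ (onZ (qs⊆ q∈))) ∷ qs-chain
          ; s⟶q = dominated 7 (m≤m+n 5 2) fS₂ ∷ dominated 5 (m≤m+n 5 0) fS₁ ∷ All.tabulate
              (λ q∈ → proj₂ (proj₂ (proj₂ (onZ (qs⊆ q∈)))))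
          ; r⟶q₁ = r⟶p₂ ; q₂⟶r = p₁⟶r
          ; r⟶qs = All.tabulate (λ q∈ → proj₁ (proj₂ (proj₂ (onZ (qs⊆ q∈)))))
          ; long = ≤-trans (n≤1+n _) (≤-reflexive (sym len)) }
          where
          onZ : ∀ {q} → q ∈ Z → p₁ ⟶ q × p₂ ⟶ q × r ⟶ q × All (_⟶ q) (s₁ ∷ s₂ ∷ s₃ ∷ s₄ ∷ s₅ ∷ [])
          onZ {q} q∈ with fwd-Forward F₈ 8 q (proj₂ (∈-select⁻ {p = fwd F₈ 8} {xs = W 8} q∈))
          ... | a ∷ b ∷ c ∷ d = a , b , c , dominated 8 (m≤m+n 5 3) d

    third : ℕ
    third = length (W 2) / 3

    -- The segments 0, 1 and 2 of the chain are for `y`, `m` and `z`, whose mutual edges are thereby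
    -- known.
    D : ℕ → List V
    D = chunk 𝒯 third (W 2)

    D⊆ : ∀ i → D i ⊆ W 2
    D⊆ = chunk-⊆ 𝒯 third (W 2)

    D-large : ∀ {i} → i < 3 → length (W 2) ≤ 6 * length (D i)
    D-large {i} i<3 = begin
      length (W 2)               ≡⟨ m≡m%n+[m/n]*n (length (W 2)) 3 ⟩
      length (W 2) % 3 + third * 3 ≤⟨ +-monoˡ-≤ (third * 3) (<⇒≤ (m%n<n (length (W 2)) 3)) ⟩
      3 + third * 3              ≤⟨ +-monoˡ-≤ (third * 3) (*-monoˡ-≤ 3 {1} {third} (m≥n⇒m/n>0 3≤D)) ⟩
      third * 3 + third * 3      ≡⟨ lemma third ⟩
      6 * third                  ≡⟨ cong (6 *_) (sym (length-chunk 𝒯 third (W 2) i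
          (≤-trans (*-monoˡ-≤ third i<3) (≤-trans (≤-reflexive (*-comm 3 third)) (m/n*n≤m (length (W 2)) 3))))) ⟩
      6 * length (D i)           ∎
      where
      open ≤-Reasoning
      lemma : ∀ q → q * 3 + q * 3 ≡ 6 * q
      lemma = solve-∀

    D-ordered : ∀ {i j} → i < j → ∀ {x y} → x ∈ D i → y ∈ D j → x ⟶ y
    D-ordered = chunk-distinct 𝒯 third chain

    full : ∀ {l} → l ≤ 1 * l
    full {l} = ≤-reflexive (sym (*-identityˡ _))

    record Triple (F : List (ℕ × V)) : Set where
      field
        {a y w} : V
        a∈  : a ∈ W 0
        y∈  : y ∈ W 2
        w∈  : w ∈ W 4
        w⟶y : w ⟶ y
        y⟶a : y ⟶ a
        w⟶a : w ⟶ a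
        fa  : Forward F 0 a
        fy  : Forward F 2 y
        fw₄ : Forward F 4 w

    -- `b`, `c` and `r` are given first, so that the triple can be chosen forward to them. Next
    -- comes the back edge `r′ ⟶ m`, so that `a`, `w`, `y` and `z` can be chosen forward to `r′`,
    -- and `a` and `w` forward to `m`.
    triple : ∀ {b c r} → b ∈ W 1 → c ∈ W 3 → r ∈ W 6 → Triple ((1 , b) ∷ (3 , c) ∷ (6 , r) ∷ [])
    triple {b} {c} {r} b∈ c∈ r∈ = withCentre (backEdge (m≤m+n 3 3) 6<9 (D⊆ 1) ⊆-refl
        (relax (D 1) (m≤m+n 6 10) (D-large {1} (m≤m+n 2 1))) (relax (W 6) (m≤m+n 1 15) full))
      where
      F₀ : List (ℕ × V)
      F₀ = (1 , b) ∷ (3 , c) ∷ (6 , r) ∷ []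
      withCentre : (∃₂ λ m r′ → m ∈ D 1 × r′ ∈ W 6 × r′ ⟶ m) → Triple F₀
      withCentre (m , r′ , m∈ , r′∈ , r′⟶m) = withEnds (backEdge (m≤m+n 1 3) (m≤m+n 5 4)
          (⊆-trans (select-⊆ _) (select-⊆ (W 0))) (⊆-trans (select-⊆ _) (select-⊆ (W 4))) A″-large B″-large)
        where
        F₁ F₂ : List (ℕ × V)
        F₁ = (6 , r′) ∷ F₀
        F₂ = (2 , m) ∷ F₁
        placed₁ : All (Placed W) F₁
        placed₁ = (6<9 , r′∈) ∷ (m≤m+n 2 7 , b∈) ∷ (m≤m+n 4 5 , c∈) ∷ (6<9 , r∈) ∷ []
        placed₂ : All (Placed W) F₂
        placed₂ = (m≤m+n 3 6 , ⊆-lookup (D⊆ 1) m∈) ∷ placed₁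
        D₀ D₂ A′ B′ A″ B″ : List V
        D₀ = restrict F₁ 2 (D 0)
        D₂ = restrict F₁ 2 (D 2)
        A′ = restrict F₂ 0 (W 0)
        B′ = restrict F₂ 4 (W 4)
        -- Every `a` in `A″` has some `z ⟶ a` in the last segment, and every `w` in `B″` some
        -- `w ⟶ y` in the first; it remains to find `w ⟶ a`.
        A″ = hitting 0 2 A′ D₂
        B″ = hitting 4 2 B′ D₀
        D-restricted : ∀ i → i < 3 → length (W 2) ≤ 16 * length (restrict F₁ 2 (D i))
        D-restricted i i<3 = relax (restrict F₁ 2 (D i)) (m≤m+n 12 4)
            (restrict-large {F₁} {a = 6} (m≤m+n 24 40) placed₁
            ((λ ()) ∷ (λ ()) ∷ (λ ()) ∷ (λ ()) ∷ []) (m≤m+n 3 6) (D⊆ i) (D-large i<3))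
        A″-large : length (W 0) ≤ 16 * length A″
        A″-large = hitting-large (λ ()) (m≤m+n 1 8) (m≤m+n 3 6) (select-⊆ (W 0)) (⊆-trans (select-⊆ (D 2)) (D⊆ 2))
          (restrict-all-large {F₂} (m≤m+n 5 59) placed₂ ((λ ()) ∷ (λ ()) ∷ (λ ()) ∷ (λ ()) ∷ (λ ()) ∷ [])
              (m≤m+n 1 8)) (D-restricted 2 ≤-refl)
        B″-large : length (W 4) ≤ 16 * length B″
        B″-large = hitting-large (λ ()) (m≤m+n 5 4) (m≤m+n 3 6) (select-⊆ (W 4)) (⊆-trans (select-⊆ (D 0)) (D⊆ 0))
          (restrict-all-large {F₂} (m≤m+n 5 59) placed₂ ((λ ()) ∷ (λ ()) ∷ (λ ()) ∷ (λ ()) ∷ (λ ()) ∷ [])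
              (m≤m+n 5 4)) (D-restricted 0 (m≤m+n 1 2))
        withEnds : (∃₂ λ a w → a ∈ A″ × w ∈ B″ × w ⟶ a) → Triple F₀
        withEnds (a , w , a∈″ , w∈″ , w⟶a) with hitting⁻ {0} {2} {A′} {D₂} a∈″ | hitting⁻ {4} {2} {B′} {D₀} w∈″
        ... | a∈′ , z , z∈′ , az | w∈′ , y , y∈′ , wy
          with ∈-select⁻ {xs = W 0} a∈′ | ∈-select⁻ {xs = W 4} w∈′ | ∈-select⁻ {xs = D 2} z∈′ | ∈-select⁻
              {xs = D 0} y∈′
        ... | a∈ , fa | w∈ , fw′ | z∈ , fz | y∈ , fy =
            cases (G y a) (G w z) refl refl (fwd-Forward F₂ 0 a fa) (fwd-Forward F₂ 4 w fw′)
                (fwd-Forward F₁ 2 y fy) (fwd-Forward F₁ 2 z fz)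
          where
          y∈D : y ∈ W 2
          y∈D = ⊆-lookup (D⊆ 0) y∈
          z∈D : z ∈ W 2
          z∈D = ⊆-lookup (D⊆ 2) z∈
          m∈D : m ∈ W 2
          m∈D = ⊆-lookup (D⊆ 1) m∈
          w⟶y : w ⟶ y
          w⟶y = ⟶-not (distinct (m≤m+n 3 6) (m≤m+n 5 4) (λ ()) y∈D w∈) (not≡true⇒≡false wy)
          z⟶a : z ⟶ a
          z⟶a = ⟶-not (distinct (m≤m+n 1 8) (m≤m+n 3 6) (λ ()) a∈ z∈D) (not≡true⇒≡false az)
          cases : ∀ p q → G y a ≡ p → G w z ≡ q → Forward F₂ 0 a → Forward F₂ 4 w → Forward F₁ 2 y → Forward F₁ 2
              z → Triple F₀
          -- If `y ⟶ a` or `w ⟶ z`, then `y` or `z` is the middle of a triple.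
          cases true  _     y⟶a _   (_ ∷ _ ∷ fa) (_ ∷ _ ∷ fw₄) (_ ∷ fy) _ = record
            { a∈ = a∈ ; y∈ = y∈D ; w∈ = w∈ ; w⟶y = w⟶y ; y⟶a = y⟶a ; w⟶a = w⟶a ; fa = fa ; fy = fy ; fw₄ = fw₄ }
          cases false true  _   w⟶z (_ ∷ _ ∷ fa) (_ ∷ _ ∷ fw₄) _ (_ ∷ fz) = record
            { a∈ = a∈ ; y∈ = z∈D ; w∈ = w∈ ; w⟶y = w⟶z ; y⟶a = z⟶a ; w⟶a = w⟶a ; fa = fa ; fy = fz ; fw₄ = fw₄ }
          -- Now `a`, `y`, `m`, `z`, `w` form a C₅ of which `r′` dominates `m` alone.
          cases false false ya  wz  (am ∷ ar ∷ _) (mw ∷ wr ∷ _) (yr ∷ _) (zr ∷ _) = ⊥-elim (no-C5+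
              (0 , m≤m+n 1 4 , a∈) (2 , m≤m+n 3 2 , y∈D) (2 , m≤m+n 3 2 , m∈D) (2 , m≤m+n 3 2 , z∈D)
                  (4 , m≤m+n 5 0 , w∈) r′∈ record
            { c5 = record
              { e₁₂ = ⟶-not (distinct (m≤m+n 3 6) (m≤m+n 1 8) (λ ()) y∈D a∈) ya
              ; e₁₃ = am
              ; e₂₃ = D-ordered {0} {1} (m≤m+n 1 0) y∈ m∈
              ; e₂₄ = D-ordered {0} {2} (m≤m+n 1 1) y∈ z∈
              ; e₃₄ = D-ordered {1} {2} (m≤m+n 2 0) m∈ z∈
              ; e₃₅ = mw
              ; e₄₅ = ⟶-not (distinct (m≤m+n 5 4) (m≤m+n 3 6) (λ ()) w∈ z∈D) wz
              ; e₄₁ = z⟶a ; e₅₁ = w⟶a ; e₅₂ = w⟶y }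
            ; e₁ = ar ; e₂ = yr ; e₃ = r′⟶m ; e₄ = zr ; e₅ = wr })

    -- Together with a triple, a back edge c ⟶ b forms a copy of C₅; if r dominates exactly one of b and c,
    -- then it can serve as h₆.
    twins : ∀ {b c r} → b ∈ W 1 → c ∈ W 3 → r ∈ W 6 → c ⟶ b → G r b ≡ G r c
    twins {b} {c} {r} b∈ c∈ r∈ c⟶b = withTriple (triple b∈ c∈ r∈)
      where
      F₀ : List (ℕ × V)
      F₀ = (1 , b) ∷ (3 , c) ∷ (6 , r) ∷ []
      withTriple : Triple F₀ → G r b ≡ G r c
      withTriple τ = cases (G r b) (G r c) refl refl fa fy fw₄
        where
        open Triple τ
        left-b : Left b
        left-b = 1 , m≤m+n 2 3 , b∈
        left-c : Left c
        left-c = 3 , m≤m+n 4 1 , c∈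
        left-a : Left a
        left-a = 0 , m≤m+n 1 4 , a∈
        left-y : Left y
        left-y = 2 , m≤m+n 3 2 , y∈
        left-w : Left w
        left-w = 4 , m≤m+n 5 0 , w∈
        cases : ∀ p q → G r b ≡ p → G r c ≡ q → Forward F₀ 0 a → Forward F₀ 2 y → Forward F₀ 4 w → G r b ≡ G r c
        cases true  true  rb rc _ _ _ = trans rb (sym rc)
        cases false false rb rc _ _ _ = trans rb (sym rc)
        -- The C₅ has the cyclic order `a`, `c`, `b`, `w`, `y`; started at `a`, it has the dominated
        -- vertex `b` in third place.
        cases true  false rb rc (ab ∷ ac ∷ ar ∷ []) (by ∷ yc ∷ yr ∷ []) (bw ∷ cw ∷ wr ∷ []) =
          ⊥-elim (no-C5+ left-a left-c left-b left-w left-y r∈ record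
            { c5 = record { e₁₂ = ac ; e₁₃ = ab ; e₂₃ = c⟶b ; e₂₄ = cw ; e₃₄ = bw
                          ; e₃₅ = by ; e₄₅ = w⟶y ; e₄₁ = w⟶a ; e₅₁ = y⟶a ; e₅₂ = yc }
            ; e₁ = ar ; e₂ = ⟶-not (distinct 6<9 (m≤m+n 4 5) (λ ()) r∈ c∈) rc ; e₃ = rb ; e₄ = wr ; e₅ = yr })
        -- The same cycle started at `y`, which puts `c` in third place.
        cases false true  rb rc (ab ∷ ac ∷ ar ∷ []) (by ∷ yc ∷ yr ∷ []) (bw ∷ cw ∷ wr ∷ []) =
          ⊥-elim (no-C5+ left-y left-a left-c left-b left-w r∈ record
            { c5 = record { e₁₂ = y⟶a ; e₁₃ = yc ; e₂₃ = ac ; e₂₄ = ab ; e₃₄ = c⟶b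
                          ; e₃₅ = cw ; e₄₅ = bw ; e₄₁ = by ; e₅₁ = w⟶y ; e₅₂ = w⟶a }
            ; e₁ = yr ; e₂ = ar ; e₃ = rc ; e₄ = ⟶-not (distinct 6<9 (m≤m+n 2 7) (λ ()) r∈ b∈) rb ; e₅ = wr })

    covered : List V → V → Bool
    covered []       v = false
    covered (r ∷ rs) v = G r v ∨ covered rs v

    covered⁻ : ∀ {v} rs → covered rs v ≡ true → ∃ λ r → r ∈ rs × r ⟶ v
    covered⁻ {v} (r ∷ rs) h with G r v in eq
    ... | true  = r , here refl , eq
    ... | false = let r′ , r′∈ , e = covered⁻ rs h in r′ , there r′∈ , e

    covered⁺ : ∀ {v r} rs → r ∈ rs → r ⟶ v → covered rs v ≡ true
    covered⁺ (r ∷ rs) (here refl) e rewrite e = refl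
    covered⁺ {v} (r ∷ rs) (there r∈) e with G r v
    ... | true  = refl
    ... | false = covered⁺ rs r∈ e

    uncovered : ∀ {v r} rs → not (covered rs v) ≡ true → r ∈ rs → r ⟶ v → ⊥
    uncovered rs nc r∈ e = contradiction (trans (sym nc) (cong not (covered⁺ rs r∈ e))) λ ()

    majority : ∀ {w} (p : V → Bool) X → length X ≡ w → 2 * count p X ≤ w → w ≤ 2 * length (select (not ∘ p) X)
    majority {w} p X refl le = +-cancelˡ-≤ w _ _ (begin
      w + w                         ≡⟨ cong (λ l → l + l) (sym (count-not {p = p} X)) ⟩
      (u + n) + (u + n)             ≡⟨ lemma u n ⟩
      2 * u + 2 * n                 ≤⟨ +-mono-≤ le (≤-reflexive (cong (2 *_) (sym (length-select X)))) ⟩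
      w + 2 * length (select (not ∘ p) X) ∎)
      where
      open ≤-Reasoning
      u = count p X
      n = count (not ∘ p) X
      lemma : ∀ u n → (u + n) + (u + n) ≡ 2 * u + 2 * n
      lemma = solve-∀

    -- By twins no back edge joins a covered and an uncovered vertex of W 1 ∪ W 3.
    no-half : ∀ rs → (∀ {r} → r ∈ rs → r ∈ W 6) → length (W 1) ≤ 16 * length (select (covered rs) (W 1)) →
              length (W 1) ≤ 16 * length (select (not ∘ covered rs) (W 1)) → ⊥
    no-half rs rs⊆ cov unc = split (length (W 3) ≤? 2 * length (select (covered rs) (W 3)))
      where
      1<3 : 1 < 3
      1<3 = m≤m+n 2 1
      3<9 : 3 < 9
      3<9 = m≤m+n 4 5
      -- The covered or the uncovered vertices are at least half of `W 3`; `backEdge` joins them to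
      -- the opposite kind in `W 1`.
      split : Dec (length (W 3) ≤ 2 * length (select (covered rs) (W 3))) → ⊥
      split (yes le) with backEdge 1<3 3<9 (select-⊆ (W 1)) (select-⊆ (W 3)) unc
          (relax (select (covered rs) (W 3)) (m≤m+n 2 14) le)
      ... | b , c , b∈ , c∈ , c⟶b with ∈-select⁻ {xs = W 1} b∈ | ∈-select⁻ {xs = W 3} c∈
      ...   | b∈W , nb | c∈W , cc with covered⁻ rs cc
      ...     | r , r∈ , r⟶c = uncovered rs nb r∈ (trans (twins b∈W c∈W (rs⊆ r∈) c⟶b) r⟶c)
      split (no ≰) with backEdge 1<3 3<9 (select-⊆ (W 1)) (select-⊆ (W 3)) cov
          (relax (select (not ∘ covered rs) (W 3)) (m≤m+n 2 14)
              (majority (covered rs) (W 3) refl (≤-trans (≤-reflexive (cong (2 *_) (sym (length-select (W 3)))))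
              (<⇒≤ (≰⇒> ≰)))))
      ... | b , c , b∈ , c∈ , c⟶b with ∈-select⁻ {xs = W 1} b∈ | ∈-select⁻ {xs = W 3} c∈
      ...   | b∈W , cb | c∈W , nc with covered⁻ rs cb
      ...     | r , r∈ , r⟶b = uncovered rs nc r∈ (trans (sym (twins b∈W c∈W (rs⊆ r∈) c⟶b)) r⟶b)

    count-out : ∀ {r} → r ∈ W 6 → 128 * count (G r) (W 1) ≤ length (W 1)
    count-out {r} r∈ = ≤-trans (*-monoʳ-≤ 128 (count-mono {p = G r} {q = back 6 1 r} (W 1) λ {b} _ e → cong not
        (⟶-asym e)))
      (smooth 6<9 (m≤m+n 2 7) (λ ()) r∈)

    -- One more `r` covers at most a further `1 / 128` of `W 1`, which takes the covered fraction
    -- from at most `1 / 16` to at most `9 / 128`, below one half. By `no-half` it cannot lie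
    -- between `1 / 16` and one half, so it stays below `1 / 16`.
    few-covered : ∀ rs → (∀ {r} → r ∈ rs → r ∈ W 6) → 16 * count (covered rs) (W 1) ≤ length (W 1)
    few-covered []       _   = ≤-trans (≤-reflexive (trans (cong (16 *_) (count-none (W 1) λ _ ())) (*-zeroʳ 16)))
        z≤n
    few-covered (r ∷ rs) rs⊆ = decide (16 * u ≤? w)
      where
      w = length (W 1)
      u = count (covered (r ∷ rs)) (W 1)
      g = count (G r) (W 1)
      u′ = count (covered rs) (W 1)
      2u≤w : 2 * u ≤ w
      2u≤w = *-cancelˡ-≤ 64 (begin
        64 * (2 * u)             ≤⟨ *-monoʳ-≤ 64 (*-monoʳ-≤ 2 (count-∨ (W 1))) ⟩
        64 * (2 * (g + u′))      ≡⟨ lemma g u′ ⟩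
        128 * g + 8 * (16 * u′)  ≤⟨ +-mono-≤ (count-out (rs⊆ (here refl)))
            (*-monoʳ-≤ 8 (few-covered rs (rs⊆ ∘ there))) ⟩
        9 * w                    ≤⟨ *-monoˡ-≤ w (m≤m+n 9 55) ⟩
        64 * w                   ∎)
        where
        open ≤-Reasoning
        lemma : ∀ g u → 64 * (2 * (g + u)) ≡ 128 * g + 8 * (16 * u)
        lemma = solve-∀
      decide : Dec (16 * u ≤ w) → 16 * u ≤ w
      decide (yes le) = le
      decide (no ≰)   = ⊥-elim (no-half (r ∷ rs) rs⊆
        (≤-trans (<⇒≤ (≰⇒> ≰)) (≤-reflexive (cong (16 *_) (sym (length-select (W 1))))))
        (relax (select (not ∘ covered (r ∷ rs)) (W 1)) (m≤m+n 2 14) (majority (covered (r ∷ rs)) (W 1) refl 2u≤w)))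

    -- Even all of `W 6` together leaves most of `W 1` uncovered, while `backEdge` finds an edge
    -- from `W 6` into the uncovered part.
    absurd : ⊥
    absurd with backEdge (m≤m+n 2 4) 6<9 (select-⊆ (W 1)) ⊆-refl
                  (relax (select (not ∘ covered (W 6)) (W 1)) (m≤m+n 2 14)
                      (majority (covered (W 6)) (W 1) refl
                      (≤-trans (*-monoˡ-≤ (count (covered (W 6)) (W 1)) (m≤m+n 2 14))
                      (few-covered (W 6) λ r∈ → r∈))))
                  (relax (W 6) (m≤m+n 1 15) full)
    ... | b , r , b∈ , r∈ , r⟶b = uncovered (W 6) (proj₂ (∈-select⁻ {xs = W 1} b∈)) r∈ r⟶b

-- Minimal counterexamples

-- Bernoulli's inequality `1 + n / m ≤ (1 + 1 / m) ^ n`, multiplied by `m * m ^ n`.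
bernoulli : ∀ m n → (m + n) * m ^ n ≤ m * suc m ^ n
bernoulli m zero    = *-monoˡ-≤ 1 (≤-reflexive (+-identityʳ m))
bernoulli m (suc n) = begin
  (m + suc n) * (m * m ^ n)              ≤⟨ m≤m+n _ (n * m ^ n) ⟩
  (m + suc n) * (m * m ^ n) + n * m ^ n  ≡⟨ lemma m n (m ^ n) ⟩
  suc m * ((m + n) * m ^ n)              ≤⟨ *-monoʳ-≤ (suc m) (bernoulli m n) ⟩
  suc m * (m * suc m ^ n)                ≡⟨ lemma₂ m (suc m ^ n) ⟩
  m * suc m ^ suc n                      ∎
  where
  open ≤-Reasoning
  lemma : ∀ m n p → (m + suc n) * (m * p) + n * p ≡ suc m * ((m + n) * p)
  lemma = solve-∀
  lemma₂ : ∀ m p → suc m * (m * p) ≡ m * (suc m * p)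
  lemma₂ = solve-∀

^-distribʳ-* : ∀ n a b → (a * b) ^ n ≡ a ^ n * b ^ n
^-distribʳ-* zero    a b = refl
^-distribʳ-* (suc n) a b rewrite ^-distribʳ-* n a b = lemma a b (a ^ n) (b ^ n)
  where
  lemma : ∀ a b x y → a * b * (x * y) ≡ a * x * (b * y)
  lemma = solve-∀

-- A small gain over a chain of nearly optimal length already is a long chain when q is large.
gain : ∀ m C q {N k d c} .{{_ : NonZero m}} → C * m ^ q ≤ suc m ^ q → N ≤ C * k ^ q → N ≤ C * d ^ q → d ≤ m * c → N
    ≤ (k + c) ^ q
gain m C q {N} {k} {d} {c} Cm≤ Nk Nd dc = *-cancelˡ-≤ (m ^ q) {{m^n≢0 m q}} (begin
  m ^ q * N                   ≤⟨ *-monoʳ-≤ (m ^ q) Ne ⟩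
  m ^ q * (C * e ^ q)         ≡⟨ lemma (m ^ q) C (e ^ q) ⟩
  C * m ^ q * e ^ q           ≤⟨ *-monoˡ-≤ (e ^ q) Cm≤ ⟩
  suc m ^ q * e ^ q           ≡⟨ sym (^-distribʳ-* q (suc m) e) ⟩
  (suc m * e) ^ q             ≤⟨ ^-monoˡ-≤ q me≤ ⟩
  (m * (k + c)) ^ q           ≡⟨ ^-distribʳ-* q m (k + c) ⟩
  m ^ q * (k + c) ^ q         ∎)
  where
  open ≤-Reasoning
  -- The minimum satisfies both `N ≤ C * e ^ q` and `suc m * e ≤ d + m * k`.
  e = d ⊓ k
  Ne : N ≤ C * e ^ q
  Ne with ⊓-sel d k
  ... | inj₁ e≡d rewrite e≡d = Nd
  ... | inj₂ e≡k rewrite e≡k = Nk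
  me≤ : suc m * e ≤ m * (k + c)
  me≤ = begin
    e + m * e     ≤⟨ +-mono-≤ (m⊓n≤m d k) (*-monoʳ-≤ m (m⊓n≤n d k)) ⟩
    d + m * k     ≤⟨ +-monoˡ-≤ (m * k) dc ⟩
    m * c + m * k ≡⟨ lemma₂ m c k ⟩
    m * (k + c)   ∎
    where
    lemma₂ : ∀ m c k → m * c + m * k ≡ m * (k + c)
    lemma₂ = solve-∀
  lemma : ∀ a b c → a * (b * c) ≡ b * a * c
  lemma = solve-∀

n≤2^n : ∀ n → n ≤ 2 ^ n
n≤2^n zero    = z≤n
n≤2^n (suc n) = +-mono-≤ (m^n>0 2 n) (≤-trans (n≤2^n n) (m≤m+n (2 ^ n) 0))

m≤m^n : ∀ m n .{{_ : NonZero n}} → m ≤ m ^ n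
m≤m^n zero    n       = z≤n
m≤m^n (suc m) (suc n) = m≤m*n (suc m) (suc m ^ n) {{m^n≢0 (suc m) n}}

-- The vertices 0–4 are s₁–s₅, 5 is r and 6, 7, … are q₁, q₂ and qs; only the values at i < j matter.
template : ℕ → ℕ → Bool
template 0 3 = false
template 0 4 = false
template 1 4 = false
template 2 5 = false
template 5 7 = false
template _ _ = true

LongChain : {V : Set} → Tournament V → ℕ → List V → Set
LongChain 𝒯 q A = ∃ λ ys → Chain 𝒯 A ys × length A ≤ length ys ^ q

module LongChains {V : Set} (𝒯 : Tournament V) (t : ℕ) (noConfig : ¬ Configurations.Config 𝒯 (2 * t)) where
  open Core 𝒯
  open Configurations 𝒯
  open Layouts 𝒯

  -- `template` has the edges that a `Config` prescribes, so it serves as the forbidden tournament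
  -- for the construction of layouts.
  noCopy : ¬ ∃ λ f → IsCopy 𝒯 (8 + 2 * t) template f
  noCopy (f , agrees , distinct) = noConfig record
    { s₁ = f 0 ; s₂ = f 1 ; s₃ = f 2 ; s₄ = f 3 ; s₅ = f 4 ; r = f 5 ; q₁ = f 6 ; q₂ = f 7
    ; qs = applyUpTo (λ i → f (8 + i)) (2 * t)
    ; c5+ = record
      { c5 = record { e₁₂ = edge 0 0 ; e₁₃ = edge 0 1 ; e₂₃ = edge 1 0 ; e₂₄ = edge 1 1 ; e₃₄ = edge 2 0
                    ; e₃₅ = edge 2 1 ; e₄₅ = edge 3 0 ; e₄₁ = reverse 0 2 ; e₅₁ = reverse 0 3 ; e₅₂ = reverse 1 2 }
      ; e₁ = edge 0 4 ; e₂ = edge 1 3 ; e₃ = reverse 2 2 ; e₄ = edge 3 1 ; e₅ = edge 4 0 }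
    ; chain = (edge 6 0 ∷ Allₚ.applyUpTo⁺₁ _ (2 * t) (far 6 λ _ → refl)) ∷ Allₚ.applyUpTo⁺₁ _ (2 * t)
        (far 7 λ _ → refl)
              ∷ AllPairsₚ.applyUpTo⁺₁ _ (2 * t) λ {i} {j} i<j j<k → agrees (+-monoʳ-< 8 i<j) (+-monoʳ-< 8 j<k)
    ; s⟶q = (edge 0 5 ∷ edge 1 4 ∷ edge 2 3 ∷ edge 3 2 ∷ edge 4 1 ∷ []) ∷
        (edge 0 6 ∷ edge 1 5 ∷ edge 2 4 ∷ edge 3 3 ∷ edge 4 2 ∷ [])
            ∷ Allₚ.applyUpTo⁺₁ _ (2 * t) λ i<k → far 0 (λ _ → refl) i<k ∷ far 1 (λ _ → refl) i<k ∷ far 2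
                (λ _ → refl) i<k ∷ far 3 (λ _ → refl) i<k ∷ far 4 (λ _ → refl) i<k ∷ []
    ; r⟶q₁ = edge 5 0 ; q₂⟶r = reverse 5 1 ; r⟶qs = Allₚ.applyUpTo⁺₁ _ (2 * t) (far 5 λ _ → refl)
    ; long = ≤-reflexive (sym (length-applyUpTo (λ i → f (8 + i)) (2 * t))) }
    where
    edge : ∀ i d {_ : True (suc i + d <? 8)} {_ : True (template i (suc i + d) ≟ᵇ true)} → f i ⟶ f (suc i + d)
    edge i d {lt} {e} = trans (agrees (m≤m+n (suc i) d) (≤-trans (toWitness lt) (m≤m+n 8 (2 * t)))) (toWitness e)
    reverse : ∀ i d {_ : True (suc i + d <? 8)} {_ : True (template i (suc i + d) ≟ᵇ false)} → f (suc i + d) ⟶ f i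
    reverse i d {lt} {e} = ⟶-not (distinct (m≤m+n (suc i) d) lt′)
        (trans (agrees (m≤m+n (suc i) d) lt′) (toWitness e))
      where lt′ = ≤-trans (toWitness lt) (m≤m+n 8 (2 * t))
    far : ∀ i {_ : True (i <? 8)} → (∀ j → template i (8 + j) ≡ true) → ∀ {j} → j < 2 * t → f i ⟶ f (8 + j)
    far i {lt} e {j} j<k = trans (agrees (≤-trans (toWitness lt) (m≤m+n 8 j)) (+-monoʳ-< 8 j<k)) (e j)

  -- Decidability makes the case distinction at a minimal counterexample constructive. The search
  -- runs over the first vertex of the chain.
  hasChain? : ∀ k A → Dec (∃ λ ys → Chain 𝒯 A ys × length ys ≡ k)
  hasChain? zero    A = yes ([] , ([] , λ ()) , refl)
  hasChain? (suc k) A = map′ extend shrink (Any.any? (λ x → hasChain? k (select (G x) A)) A)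
    where
    extend : Any (λ x → ∃ λ ys → Chain 𝒯 (select (G x) A) ys × length ys ≡ k) A → ∃ λ ys → Chain 𝒯 A ys × length ys
        ≡ suc k
    extend any with find any
    ... | x , x∈ , ys , (ch , ys⊆) , len = x ∷ ys , (All.tabulate (λ y∈ → proj₂ (∈-select⁻ {xs = A} (ys⊆ y∈))) ∷ ch
        , mem) , cong suc len
      where
      mem : ∀ {y} → y ∈ x ∷ ys → y ∈ A
      mem (here refl) = x∈
      mem (there y∈)  = proj₁ (∈-select⁻ {p = G x} (ys⊆ y∈))
    shrink : (∃ λ ys → Chain 𝒯 A ys × length ys ≡ suc k) → Any
        (λ x → ∃ λ ys → Chain 𝒯 (select (G x) A) ys × length ys ≡ k) A
    shrink (x ∷ ys , (x⟶ys ∷ ch , ys⊆) , refl) =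
      lose (ys⊆ (here refl)) (ys , (ch , λ y∈ → ∈-select⁺ (ys⊆ (there y∈)) (All.lookup x⟶ys y∈)) , refl)

  longChain? : ∀ q .{{_ : NonZero q}} A → Dec (LongChain 𝒯 q A)
  longChain? q A = map′ to from (anyUpTo? (λ k → hasChain? k A ×-dec (length A ≤? k ^ q)) (suc (length A)))
    where
    N = length A
    Found : Set
    Found = ∃ λ k → k < suc N × (∃ λ ys → Chain 𝒯 A ys × length ys ≡ k) × N ≤ k ^ q
    to : Found → LongChain 𝒯 q A
    to (k , _ , (ys , ch , refl) , le) = ys , ch , le
    from : LongChain 𝒯 q A → Found
    from (ys , (ch , ys⊆) , le) with length ys ≤? N
    ... | yes short = length ys , s≤s short , (ys , (ch , ys⊆) , refl) , le
    -- Cutting to `N` vertices is harmless since `N ≤ N ^ q`; this bounds the search.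
    ... | no  long  = N , ≤-refl , (take N ys , (AllPairsₚ.take⁺ N ch , ys⊆ ∘ ⊆-lookup (take-⊆ N ys)) ,
                        trans (length-take N ys) (m≤n⇒m⊓n≡m (<⇒≤ (≰⇒> long)))) , m≤m^n N q

  no-critical : ∀ {K q A} → 16 * K * 32 ^ q ≤ 33 ^ q → Unique A → HasChains q A → ¬ LongChain 𝒯 q A →
                2 * 2 ^ (2 * t) * K ≤ length A → .{{_ : NonZero K}} → Layout 9 128 K q A → ⊥
  no-critical {K} {q} {A} Kq uniq chains noLong big L =
    Find.absurd t noConfig W smooth distinct chain 3≤D (AllPairs-resp-⊆ (W⊆ ≤-refl (λ ())) uniq) long backEdge
    where
    open Layout L
    3≤D : 3 ≤ length (W 2)
    3≤D = *-cancelˡ-≤ 2 (≤-trans 6≤d d≤)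
    long : 2 * 2 ^ (2 * t) ≤ length (W 8)
    long = *-cancelʳ-≤ _ _ K (≤-trans big (≤-trans (large ≤-refl (λ ())) (≤-reflexive (*-comm K _))))

    -- `e` is a nearly optimal length, of which `ys` attains a constant fraction. Outside `W 2` the
    -- induction hypothesis for `X` gives a `ys` of length `e`. Inside `W 2`, `X` is itself a chain
    -- and keeps `1 / 32` of `d`: a factor 2 is due to smoothing and 16 to the passage to `X`.
    record Fat (i : ℕ) (X : List V) : Set where
      field
        {ys} : List V
        ch   : Chain 𝒯 X ys
        e    : ℕ
        N≤   : length A ≤ 16 * K * e ^ q
        e≤   : e ≤ 32 * length ys
        e≤′  : i ≢ 2 → e ≤ length ys

    linear : ∀ {i X} → i ≢ 2 → i < 9 → X ⊆ W i → length (W i) ≤ 16 * length X → Fat i X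
    linear {i} {X} i≢2 i<9 X⊆ le with chains X (AllPairs-resp-⊆ (⊆-trans X⊆ (W⊆ i<9 i≢2)) uniq)
        (≤-<-trans (length-mono-≤ X⊆) (small i<9 i≢2))
    ... | ys , ch , X≤ = record
      { ch = ch ; e = length ys
      ; N≤ = ≤-trans (large i<9 i≢2) (≤-trans (*-monoʳ-≤ K (≤-trans le (*-monoʳ-≤ 16 X≤)))
          (≤-reflexive (lemma K (length ys ^ q))))
      ; e≤ = m≤n*m (length ys) 32 ; e≤′ = λ _ → ≤-refl }
      where
      lemma : ∀ k p → k * (16 * p) ≡ 16 * k * p
      lemma = solve-∀

    middle : ∀ {X} → X ⊆ W 2 → length (W 2) ≤ 16 * length X → Fat 2 X
    middle {X} X⊆ le = record
      { ch = AllPairs-resp-⊆ X⊆ chain , (λ y∈ → y∈) ; e = d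
      ; N≤ = ≤-trans d-large (*-monoˡ-≤ (d ^ q) (m≤n*m K 16))
      ; e≤ = ≤-trans d≤ (≤-trans (*-monoʳ-≤ 2 le) (≤-reflexive (sym (*-assoc 2 16 (length X))))) ; e≤′ = λ 2≢2 →
          contradiction refl 2≢2 }

    fat : ∀ {i X} → i < 9 → X ⊆ W i → length (W i) ≤ 16 * length X → Fat i X
    fat {i} i<9 X⊆ le with i ≟ 2
    ... | yes refl = middle X⊆ le
    ... | no i≢2   = linear i≢2 i<9 X⊆ le

    -- Without a back edge the chains in `X` and `Y` could be concatenated. As `i` and `j` are not
    -- both 2, one of these chains is nearly optimal, and the other is long enough for `gain` to
    -- contradict `noLong`.
    backEdge : ∀ {i j} → i < j → j < 9 → ∀ {X Y} → X ⊆ W i → Y ⊆ W j →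
               length (W i) ≤ 16 * length X → length (W j) ≤ 16 * length Y →
               ∃₂ λ x y → x ∈ X × y ∈ Y × y ⟶ x
    backEdge {i} {j} i<j j<9 {X} {Y} X⊆ Y⊆ lX lY with Any.any? (λ x → Any.any? (λ y → G y x ≟ᵇ true) Y) X
    ... | yes any with find any
    ...   | x , x∈ , any′ with find any′
    ...     | y , y∈ , y⟶x = x , y , x∈ , y∈ , y⟶x
    backEdge {i} {j} i<j j<9 {X} {Y} X⊆ Y⊆ lX lY | no ¬any = ⊥-elim (tooLong (fat i<9 X⊆ lX) (fat j<9 Y⊆ lY))
      where
      i<9 = <-trans i<j j<9
      forward : ∀ {x y} → x ∈ X → y ∈ Y → x ⟶ y
      forward x∈ y∈ = ⟶-not (distinct j<9 i<9 (<⇒≢ i<j ∘ sym) (⊆-lookup Y⊆ y∈) (⊆-lookup X⊆ x∈))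
        (¬-not λ y⟶x → ¬any (lose x∈ (lose y∈ y⟶x)))
      tooLong : Fat i X → Fat j Y → ⊥
      tooLong φ φ′ = noLong
        (F.ys ++ F′.ys , (AllPairsₚ.++⁺ (proj₁ F.ch) (proj₁ F′.ch)
            (All.tabulate λ x∈ → All.tabulate λ y∈ → forward (proj₂ F.ch x∈) (proj₂ F′.ch y∈)) , mem) ,
         subst (λ l → length A ≤ l ^ q) (sym (length-++ F.ys)) (N≤ (i ≟ 2)))
        where
        module F  = Fat φ
        module F′ = Fat φ′
        mem : ∀ {y} → y ∈ F.ys ++ F′.ys → y ∈ A
        mem y∈ with Anyₚ.++⁻ F.ys y∈
        ... | inj₁ y∈₁ = W∈ i<9 (⊆-lookup X⊆ (proj₂ F.ch y∈₁))
        ... | inj₂ y∈₂ = W∈ j<9 (⊆-lookup Y⊆ (proj₂ F′.ch y∈₂))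
        N≤ : Dec (i ≡ 2) → length A ≤ (length F.ys + length F′.ys) ^ q
        N≤ (no i≢2)   = gain 32 (16 * K) q Kq (≤-trans F.N≤ (*-monoʳ-≤ (16 * K) (^-monoˡ-≤ q (F.e≤′ i≢2)))) F′.N≤
            F′.e≤
        N≤ (yes refl) = subst (λ l → length A ≤ l ^ q) (+-comm (length F′.ys) _)
          (gain 32 (16 * K) q Kq (≤-trans F′.N≤ (*-monoʳ-≤ (16 * K) (^-monoˡ-≤ q (F′.e≤′ (<⇒≢ i<j ∘ sym))))) F.N≤
              F.e≤)

  module Induction {K N q : ℕ} .{{_ : NonZero K}} (0<q : 0 < q)
                   (mkLayout : ∀ q A → Unique A → N ≤ length A → HasChains q A → Layout 9 128 K q A)
                   (Kq : 16 * K * 32 ^ q ≤ 33 ^ q) (Nq : N + 2 * 2 ^ (2 * t) * K ≤ q) where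

    instance
      q≢0 : NonZero q
      q≢0 = >-nonZero 0<q

    threshold : ℕ
    threshold = N + 2 * 2 ^ (2 * t) * K

    -- Since `length A ≤ threshold ≤ q ≤ 2 ^ q`, two vertices suffice.
    small : ∀ A → Unique A → length A ≤ threshold → LongChain 𝒯 q A
    small []          _    _  = [] , ([] , λ ()) , z≤n
    small (x ∷ [])    _    _  = x ∷ [] , (([] ∷ []) , λ y∈ → y∈) , ≤-reflexive (sym (^-zeroˡ q))
    small A@(_ ∷ _ ∷ _) uniq le with log-chain 𝒯 1 A uniq (s≤s (s≤s z≤n))
    ... | ys , ch , len = ys , ch , ≤-trans le (≤-trans Nq
        (≤-trans (n≤2^n q) (≤-reflexive (cong (_^ q) (sym len)))))

    -- Strong induction on the length, with `n` as fuel; its hypothesis is `HasChains`.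
    search : ∀ n A → Unique A → length A < n → LongChain 𝒯 q A
    search (suc n) A uniq (s≤s A≤n) with length A ≤? threshold
    ... | yes le = small A uniq le
    ... | no ≰ with longChain? q A
    ...   | yes found  = found
    ...   | no noLong = ⊥-elim (no-critical Kq uniq chains noLong (≤-trans (m≤n+m _ N) big)
              (mkLayout q A uniq (≤-trans (m≤m+n N _) big) chains))
      where
      big : threshold ≤ length A
      big = <⇒≤ (≰⇒> ≰)
      chains : HasChains q A
      chains B uniqB B<A = search n B uniqB (≤-trans B<A A≤n)

  weaken : ∀ {K q A} → Layout 9 128 K q A → Layout 9 128 (suc K) q A
  weaken L = record { Layout L ; large = λ i<9 i≢2 → ≤-trans (Layout.large L i<9 i≢2) (m≤n+m _ _)
                    ; d-large = ≤-trans (Layout.d-large L) (m≤n+m _ _) }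

-- Choice of the exponent

LayoutsExist : ℕ → ℕ → ℕ → Set₁
LayoutsExist t K N = ∀ {V : Set} (𝒯 : Tournament V) H → (¬ ∃ λ f → IsCopy 𝒯 (8 + 2 * t) H f) →
  ∀ q A → Unique A → N ≤ length A → Layouts.HasChains 𝒯 q A → Layouts.Layout 𝒯 9 128 K q A

long-chain : ∀ {t K N q} → 0 < q → 16 * suc K * 32 ^ q ≤ 33 ^ q → N + 2 * 2 ^ (2 * t) * suc K ≤ q → LayoutsExist t
    K N →
             ∀ {V : Set} (𝒯 : Tournament V) → ¬ Configurations.Config 𝒯 (2 * t) → ∀ A → Unique A → LongChain 𝒯 q A
long-chain {t} {K} {N} {q} 0<q Kq Nq mkLayout 𝒯 noConfig A uniq =
  Induction.search {suc K} {N} {q} 0<q (λ q A uniq N≤ chains → weaken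
      (mkLayout 𝒯 template noCopy q A uniq N≤ chains)) Kq Nq (suc (length A)) A uniq ≤-refl
  where open LongChains 𝒯 t noConfig

exponent : ∀ K M → ∃ λ q → 0 < q × 16 * K * 32 ^ q ≤ 33 ^ q × M ≤ q
-- By Bernoulli `(33 / 32) ^ (32 * C)` is at least `1 + C`, and `C` exceeds both `16 * K` and `M`.
exponent K M = 32 * C , s≤s z≤n , Kq C (m≤m+n (16 * K) M) , ≤-trans (m≤n+m M (16 * K))
    (≤-trans (n≤1+n _) (m≤n*m C 32))
  where
  C : ℕ
  C = suc (16 * K + M)
  Kq : ∀ C → 16 * K ≤ pred C → 16 * K * 32 ^ (32 * C) ≤ 33 ^ (32 * C)
  Kq C le = *-cancelˡ-≤ 32 (begin
    32 * (16 * K * 32 ^ q)    ≤⟨ *-monoʳ-≤ 32 (*-monoˡ-≤ (32 ^ q) (≤-trans le (≤-trans pred[n]≤n (n≤1+n C)))) ⟩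
    32 * (suc C * 32 ^ q)     ≡⟨ lemma C (32 ^ q) ⟩
    (32 + 32 * C) * 32 ^ q    ≤⟨ bernoulli 32 q ⟩
    32 * 33 ^ q               ∎)
    where
    open ≤-Reasoning
    q = 32 * C
    lemma : ∀ c p → 32 * (suc c * p) ≡ (32 + 32 * c) * p
    lemma = solve-∀

long-chains : ∀ t → ∃ λ q → 0 < q × (∀ {V : Set} (𝒯 : Tournament V) → ¬ Configurations.Config 𝒯 (2 * t) →
              ∀ A → Unique A → LongChain 𝒯 q A)
long-chains t =
  let K , N , mkLayout = layout (8 + 2 * t) (m≤m+n 2 (6 + 2 * t)) 9 128 (m≤m+n 3 6) in
  pick K N mkLayout (exponent (suc K) (N + 2 * 2 ^ (2 * t) * suc K))
  where
  pick : ∀ K N → LayoutsExist t K N → (∃ λ q → 0 < q × 16 * suc K * 32 ^ q ≤ 33 ^ q × N + 2 * 2 ^ (2 * t) * suc K ≤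
      q) →
         ∃ λ q → 0 < q × (∀ {V : Set} (𝒯 : Tournament V) → ¬ Configurations.Config 𝒯 (2 * t) → ∀ A → Unique A →
             LongChain 𝒯 q A)
  pick K N mkLayout (q , 0<q , Kq , Nq) = q , 0<q , long-chain {t} {K} {N} {q} 0<q Kq Nq mkLayout

-- Copies of C₅-chains

AllPairs-lookup : {A : Set} {R : A → A → Set} {xs : List A} → AllPairs R xs → ∀ {i j} → toℕ i < toℕ j → R
    (lookup xs i) (lookup xs j)
AllPairs-lookup {xs = x ∷ xs} (p ∷ ps) {zero}  {suc j} _         = All.lookup p (∈-lookup {xs = xs} j)
AllPairs-lookup {xs = x ∷ xs} (p ∷ ps) {suc i} {suc j} (s≤s i<j) = AllPairs-lookup ps i<j

rising : ∀ l (c : Fin (suc l) → ℕ) → (∀ i → c (inject₁ i) < c (suc i)) → c zero ≤ c (fromℕ l)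
rising zero    c _ = ≤-refl
rising (suc l) c h = ≤-trans (<⇒≤ (h zero)) (rising l (c ∘ suc) (h ∘ suc))

-- The position of the path vertex with index `j` in `q₁ ∷ q₂ ∷ qs`: the indices `2i` and `2i + 1`
-- change places, which turns the backward edges of `P` into forward ones.
σ : ℕ → ℕ
σ j = if isOdd j then pred j else suc j

σ≤ : ∀ j → σ j ≤ suc j
σ≤ j with isOdd j
... | true  = ≤-trans pred[n]≤n (n≤1+n j)
... | false = ≤-refl

σ< : ∀ {i j} → i < j → (isOdd j ∧ (suc i ≡ᵇ j)) ≡ false → σ i < σ j
σ< {i} {j} i<j h with isOdd j in oj
... | false = s≤s (≤-trans (σ≤ i) i<j)
σ< {i} {suc j} (s≤s i≤j) h | true with m≤n⇒m<n∨m≡n i≤j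
... | inj₂ refl = contradiction (trans (sym (Equivalence.to T-≡ (≡⇒≡ᵇ i i refl))) h) λ ()
... | inj₁ i<j with isOdd i in oi
...   | true  = ≤-trans (s≤s pred[n]≤n) i<j
...   | false = ≤∧≢⇒< i<j λ { refl → contradiction (trans (sym oj) (cong (not ∘ not) oi)) λ () }

σ> : ∀ {i j} → (isOdd j ∧ (suc i ≡ᵇ j)) ≡ true → σ j < σ i
σ> {i} {j} h with isOdd j in oj
... | true with ≡ᵇ⇒≡ (suc i) j (≡true⇒T h)
...   | refl with isOdd i | oj
...     | false | _ = ≤-refl

-- `ρ₂` preserves parity and is a translation on each parity class.
ρ₂-injective : ∀ t a b → ρ₂ t a ≡ ρ₂ t b → a ≡ b
ρ₂-injective t a b eq with isOdd (toℕ a) in oa | isOdd (toℕ b) in ob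
... | true  | true  = toℕ-injective (+-cancelʳ-≡ 8 _ _ eq)
... | false | false = toℕ-injective (+-cancelʳ-≡ 6 _ _ eq)
... | true  | false = contradiction (trans (sym oa) (trans
    (lemma (+-cancelʳ-≡ 6 (2 + toℕ a) (toℕ b) (trans (shift (toℕ a)) eq))) ob)) λ ()
  where
  shift : ∀ x → 2 + x + 6 ≡ x + 8
  shift = solve-∀
  lemma : 2 + toℕ a ≡ toℕ b → isOdd (toℕ a) ≡ isOdd (toℕ b)
  lemma e = trans (sym (not-involutive _)) (cong isOdd e)
... | false | true  = contradiction (trans (sym ob) (trans
    (lemma (+-cancelʳ-≡ 6 (2 + toℕ b) (toℕ a) (trans (shift (toℕ b)) (sym eq)))) oa)) λ ()
  where
  shift : ∀ x → 2 + x + 6 ≡ x + 8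
  shift = solve-∀
  lemma : 2 + toℕ b ≡ toℕ a → isOdd (toℕ b) ≡ isOdd (toℕ a)
  lemma e = trans (sym (not-involutive _)) (cong isOdd e)

-- Hence `p₁`, with value 6, is the only path vertex placed before `h₆`, whose value is 7.
ρ₂≥8 : ∀ t (b : Fin (2 * t)) → 8 ≤ ρ₂ t (suc b)
ρ₂≥8 t b with toℕ b
... | zero = ≤ᵇ⇒≤ 8 9 _
... | suc m with isOdd m
...   | true  = m≤n+m 8 (2 + m)
...   | false = s≤s (s≤s (m≤n+m 6 m))

fromBackward-< : ∀ {n} key (bw : Digraph n) {x y} → key x < key y → fromBackward key bw x y ≡ not (bw y x)
fromBackward-< key bw lt rewrite <ᵇ-true lt = refl

fromBackward-> : ∀ {n} key (bw : Digraph n) {x y} → key y < key x → fromBackward key bw x y ≡ bw x y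
fromBackward-> key bw lt rewrite <ᵇ-true lt | <ᵇ-false (<⇒≤ lt) = refl

fromBackward-diag : ∀ {n} key (bw : Digraph n) x → fromBackward key bw x x ≡ false
fromBackward-diag key bw x rewrite <ᵇ-false (≤-refl {key x}) = refl

Hl-reordered : ∀ a b → fromBackward ρ₁ (backwardOf ρ₁ Hl) a b ≡ Hl a b
Hl-reordered = toWitness {a? = all? λ a → all? λ b → fromBackward ρ₁ (backwardOf ρ₁ Hl) a b ≟ᵇ Hl a b} _

Hl-semicomplete : ∀ a b → a ≡ b ⊎ Hl a b ≡ true ⊎ Hl b a ≡ true
Hl-semicomplete = toWitness {a? = all? λ a → all? λ b → (a ≟ᶠ b) ⊎-dec ((Hl a b ≟ᵇ true) ⊎-dec (Hl b a ≟ᵇ true))} _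

module Final {n} (T : Digraph n) (isTournament : IsTournament T) where

  𝒯 : Tournament (Fin n)
  𝒯 = record { G = T ; irr = proj₁ isTournament ; total = proj₂ isTournament _ _ }

  open Core 𝒯
  open Configurations 𝒯

  chain-lookup : ∀ {ys} → AllPairs _⟶_ ys → ∀ i j → lookup ys i ⟶ lookup ys j → toℕ i < toℕ j
  chain-lookup {ys} ch i j e with <-cmp (toℕ i) (toℕ j)
  ... | tri< i<j _ _ = i<j
  ... | tri≈ _ i≡j _ with toℕ-injective {i = i} {j} i≡j
  ...   | refl = contradiction (trans (sym e) (irr (lookup ys i))) λ ()
  chain-lookup {ys} ch i j e | tri> _ _ j<i = contradiction (trans (sym e) (⟶-asym (AllPairs-lookup ch j<i))) λ ()

  -- An edge between chain vertices raises the position, so a directed cycle could not close.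
  chain⇒transitive : ∀ {ys} → AllPairs _⟶_ ys → HasTransitiveSub T (length ys)
  chain⇒transitive {ys} ch = lookup ys , inj , acyclic
    where
    inj : Injective _≡_ _≡_ (lookup ys)
    inj {i} {j} eq with <-cmp (toℕ i) (toℕ j)
    ... | tri< i<j _ _ = contradiction eq (⟶⇒≢ (AllPairs-lookup ch i<j))
    ... | tri≈ _ i≡j _ = toℕ-injective i≡j
    ... | tri> _ _ j<i = contradiction (sym eq) (⟶⇒≢ (AllPairs-lookup ch j<i))
    acyclic : Transitive (induced T (lookup ys))
    acyclic (l , c , _ , path , closing) = <⇒≱ (chain-lookup ch _ _ closing)
      (rising l (toℕ ∘ c) (λ i → chain-lookup ch _ _ (path i)))

  module _ {s₁ s₂ s₃ s₄ s₅ r} (c5+ : C5+ s₁ s₂ s₃ s₄ s₅ r) where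
    open C5+ c5+
    open C5 c5

    vertex : Fin 6 → Fin n
    vertex 0F = s₁
    vertex 1F = s₂
    vertex 2F = s₃
    vertex 3F = s₄
    vertex 4F = s₅
    vertex 5F = r

    edges : ∀ a b → T (vertex a) (vertex b) ≡ Hl a b
    edges 0F 0F = irr _
    edges 0F 1F = e₁₂
    edges 0F 2F = e₁₃
    edges 0F 3F = ⟶-asym e₄₁
    edges 0F 4F = ⟶-asym e₅₁
    edges 0F 5F = e₁
    edges 1F 0F = ⟶-asym e₁₂
    edges 1F 1F = irr _
    edges 1F 2F = e₂₃
    edges 1F 3F = e₂₄
    edges 1F 4F = ⟶-asym e₅₂
    edges 1F 5F = e₂
    edges 2F 0F = ⟶-asym e₁₃
    edges 2F 1F = ⟶-asym e₂₃
    edges 2F 2F = irr _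
    edges 2F 3F = e₃₄
    edges 2F 4F = e₃₅
    edges 2F 5F = ⟶-asym e₃
    edges 3F 0F = e₄₁
    edges 3F 1F = ⟶-asym e₂₄
    edges 3F 2F = ⟶-asym e₃₄
    edges 3F 3F = irr _
    edges 3F 4F = e₄₅
    edges 3F 5F = e₄
    edges 4F 0F = e₅₁
    edges 4F 1F = e₅₂
    edges 4F 2F = ⟶-asym e₃₅
    edges 4F 3F = ⟶-asym e₄₅
    edges 4F 4F = irr _
    edges 4F 5F = e₅
    edges 5F 0F = ⟶-asym e₁
    edges 5F 1F = ⟶-asym e₂
    edges 5F 2F = e₃
    edges 5F 3F = ⟶-asym e₄
    edges 5F 4F = ⟶-asym e₅
    edges 5F 5F = irr _

  opposite⇒≢ : ∀ {x y c} → T x y ≡ not c × T y x ≡ c → x ≢ y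
  opposite⇒≢ (e , e′) refl = not-¬ e′ e

  module Embedding (t : ℕ) (κ : Config (2 * t)) where
    open Config κ

    L : List (Fin n)
    L = q₁ ∷ q₂ ∷ qs

    index : Fin (suc (2 * t)) → Fin (length L)
    -- `σ` sends the last index `2 * t` to `2 * t + 1`, so `2 * t + 2` positions are needed: `q₁`,
    -- `q₂` and those guaranteed by `long`.
    index b = fromℕ< {σ (toℕ b)} (s≤s (≤-trans (σ≤ (toℕ b)) (s≤s (≤-trans (≤-pred (toℕ<n b)) long))))

    toℕ-index : ∀ b → toℕ (index b) ≡ σ (toℕ b)
    toℕ-index b = toℕ-fromℕ< _

    p : Fin (suc (2 * t)) → Fin n
    p b = lookup L (index b)

    p-chain : ∀ a b → σ (toℕ a) < σ (toℕ b) → p a ⟶ p b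
    p-chain a b lt = AllPairs-lookup chain (subst₂ _<_ (sym (toℕ-index a)) (sym (toℕ-index b)) lt)

    p-edge : ∀ a b → toℕ a < toℕ b → T (p a) (p b) ≡ not (P-back t b a) × T (p b) (p a) ≡ P-back t b a
    p-edge a b a<b with P-back t b a in eq
    ... | true  = let e = p-chain b a (σ> {toℕ a} {toℕ b} eq) in ⟶-asym e , e
    ... | false = let e = p-chain a b (σ< {toℕ a} {toℕ b} a<b eq) in e , ⟶-asym e

    p-copy : ∀ a b → T (p a) (p b) ≡ P t a b
    p-copy a b with <-cmp (toℕ a) (toℕ b)
    ... | tri< a<b _ _ = trans (proj₁ (p-edge a b a<b)) (sym (fromBackward-< toℕ (P-back t) {a} {b} a<b))
    ... | tri> _ _ b<a = trans (proj₂ (p-edge b a b<a)) (sym (fromBackward-> toℕ (P-back t) {a} {b} b<a))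
    ... | tri≈ _ a≡b _ with toℕ-injective a≡b
    ...   | refl = trans (irr _) (sym (fromBackward-diag toℕ (P-back t) a))

    p-distinct : ∀ {a b} → a ≢ b → p a ≢ p b
    p-distinct {a} {b} a≢b with <-cmp (toℕ a) (toℕ b)
    ... | tri< a<b _ _ = opposite⇒≢ (p-edge a b a<b)
    ... | tri≈ _ a≡b _ = contradiction (toℕ-injective a≡b) a≢b
    ... | tri> _ _ b<a = opposite⇒≢ (p-edge b a b<a) ∘ sym

    v : Fin 6 → Fin n
    v = vertex c5+

    r⟶lookup : ∀ i → toℕ i ≢ 1 → r ⟶ lookup L i
    r⟶lookup zero          _   = r⟶q₁
    r⟶lookup (suc zero)    ne  = contradiction refl ne
    r⟶lookup (suc (suc i)) _   = All.lookup r⟶qs (∈-lookup {xs = qs} i)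

    -- Position 1, that of `q₂`, is `σ 0`, so no later path vertex occupies it.
    r⟶p : ∀ b → r ⟶ p (suc b)
    r⟶p b = r⟶lookup (index (suc b)) (subst (_≢ 1) (sym (toℕ-index (suc b))) (σ≢1 (toℕ b)))
      where
      σ≢1 : ∀ m → σ (suc m) ≢ 1
      σ≢1 m with isOdd m in odd
      ... | true  = λ ()
      ... | false = λ { refl → contradiction odd λ () }

    s⟶p : ∀ b → All (_⟶ p b) (s₁ ∷ s₂ ∷ s₃ ∷ s₄ ∷ s₅ ∷ [])
    s⟶p b = All.lookup s⟶q (∈-lookup {xs = L} (index b))

    6≤ρ₂ : ∀ b → 6 ≤ ρ₂ t b
    6≤ρ₂ zero    = ≤-refl
    6≤ρ₂ (suc b) = ≤-trans (m≤m+n 6 2) (ρ₂≥8 t b)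

    -- Between the two factors of the product every edge goes forward under the combined key; `p₁`
    -- before `h₆` is the only case with the path vertex first.
    v-vs-p : ∀ a b → (v a ⟶ p b × ρ₁ a < ρ₂ t b) ⊎ (p b ⟶ v a × ρ₂ t b < ρ₁ a)
    v-vs-p 0F b       = inj₁ (All.lookup (s⟶p b) (here refl) , ≤-trans (m≤m+n 2 4) (6≤ρ₂ b))
    v-vs-p 1F b       = inj₁ (All.lookup (s⟶p b) (there (here refl)) , ≤-trans (m≤m+n 3 3) (6≤ρ₂ b))
    v-vs-p 2F b       = inj₁ (All.lookup (s⟶p b) (there (there (here refl))) , ≤-trans (m≤m+n 4 2) (6≤ρ₂ b))
    v-vs-p 3F b       = inj₁ (All.lookup (s⟶p b) (there (there (there (here refl)))) , ≤-trans (m≤m+n 5 1) (6≤ρ₂ b))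
    v-vs-p 4F b       = inj₁ (All.lookup (s⟶p b) (there (there (there (there (here refl))))) , 6≤ρ₂ b)
    v-vs-p 5F zero    = inj₂ (q₂⟶r , ≤-refl)
    v-vs-p 5F (suc b) = inj₁ (r⟶p b , ρ₂≥8 t b)

    v≢p : ∀ a b → v a ≢ p b
    v≢p a b with v-vs-p a b
    ... | inj₁ (e , _) = ⟶⇒≢ e
    ... | inj₂ (e , _) = ⟶⇒≢ e ∘ sym

    -- A tournament is recovered from its backward edges under any injective key, so ordering `P` by
    -- `ρ₂` instead of by index changes nothing.
    pp-copy : ∀ a b → T (p a) (p b) ≡ fromBackward (ρ₂ t) (backwardOf (ρ₂ t) (P t)) a b
    pp-copy a b with <-cmp (ρ₂ t a) (ρ₂ t b)
    ... | tri≈ _ eq _ with ρ₂-injective t a b eq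
    ...   | refl = trans (irr _) (sym (fromBackward-diag (ρ₂ t) (backwardOf (ρ₂ t) (P t)) a))
    pp-copy a b | tri< a<b _ _ = trans (total (p-distinct {a} {b} λ { refl → <-irrefl refl a<b }))
      (trans (cong not (p-copy b a)) (sym (trans (fromBackward-< (ρ₂ t) (backwardOf (ρ₂ t) (P t)) {a} {b} a<b)
          (cong (λ c → not (c ∧ P t b a)) (<ᵇ-true a<b)))))
    pp-copy a b | tri> _ _ b<a = trans (p-copy a b)
      (sym (trans (fromBackward-> (ρ₂ t) (backwardOf (ρ₂ t) (P t)) {a} {b} b<a) (cong (_∧ P t a b) (<ᵇ-true b<a))))

    place : Fin 6 ⊎ Fin (suc (2 * t)) → Fin n
    place (inj₁ a) = v a
    place (inj₂ b) = p b

    place-injective : ∀ x y → place x ≡ place y → x ≡ y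
    place-injective (inj₁ a) (inj₁ b) eq with Hl-semicomplete a b
    ... | inj₁ a≡b        = cong inj₁ a≡b
    ... | inj₂ (inj₁ ab)  = contradiction eq (⟶⇒≢ (trans (edges c5+ a b) ab))
    ... | inj₂ (inj₂ ba)  = contradiction (sym eq) (⟶⇒≢ (trans (edges c5+ b a) ba))
    place-injective (inj₁ a) (inj₂ b) eq = ⊥-elim (v≢p a b eq)
    place-injective (inj₂ a) (inj₁ b) eq = ⊥-elim (v≢p b a (sym eq))
    place-injective (inj₂ a) (inj₂ b) eq with a ≟ᶠ b
    ... | yes a≡b = cong inj₂ a≡b
    ... | no a≢b  = contradiction eq (p-distinct {a} {b} a≢b)

    copy : ∀ i j → T (place (splitAt 6 i)) (place (splitAt 6 j)) ≡ C5chain t i j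
    copy i j with splitAt 6 i | splitAt 6 j
    ... | inj₁ a | inj₁ b = trans (edges c5+ a b) (sym (Hl-reordered a b))
    ... | inj₂ a | inj₂ b = pp-copy a b
    ... | inj₁ a | inj₂ b with v-vs-p a b
    ...   | inj₁ (e , lt) rewrite <ᵇ-true lt = e
    ...   | inj₂ (e , lt) rewrite <ᵇ-true lt | <ᵇ-false (<⇒≤ lt) = ⟶-asym e
    copy i j | inj₂ a | inj₁ b with v-vs-p b a
    ...   | inj₁ (e , lt) rewrite <ᵇ-true lt | <ᵇ-false (<⇒≤ lt) = ⟶-asym e
    ...   | inj₂ (e , lt) rewrite <ᵇ-true lt = e

    contains : Contains T (C5chain t)
    contains = place ∘ splitAt 6 , (λ {i} {j} eq → splitAt-injective i j (place-injective _ _ eq)) , copy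
      where
      splitAt-injective : ∀ (i j : Fin (6 + suc (2 * t))) → splitAt 6 i ≡ splitAt 6 j → i ≡ j
      splitAt-injective i j eq = trans (sym (join-splitAt 6 (suc (2 * t)) i))
          (trans (cong (join 6 (suc (2 * t))) eq) (join-splitAt 6 (suc (2 * t)) j))

theorem17 : ∀ (t : ℕ) → Σ ℕ λ p → Σ ℕ λ q → 0 < p × 0 < q ×
    (∀ (n : ℕ) (T : Digraph n) → IsTournament T → ¬ Contains T (C5chain t) →
    Σ ℕ λ k → HasTransitiveSub T k × n ^ p ≤ k ^ q)
theorem17 t = conclude (long-chains t)
  where
  conclude : (∃ λ q → 0 < q × (∀ {V : Set} (𝒯 : Tournament V) → ¬ Configurations.Config 𝒯 (2 * t) →
               ∀ A → Unique A → LongChain 𝒯 q A)) → _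
  -- The exponent is `1 / q`: a chain of length `k` satisfies `n ≤ k ^ q`.
  conclude (q , 0<q , long-chain) = 1 , q , s≤s z≤n , 0<q , λ n T isT noCopy →
    let open Final T isT
        ys , (chain , _) , N≤ = long-chain 𝒯 (λ κ → noCopy (Embedding.contains t κ)) (allFin n) (allFin⁺ n) in
    length ys , chain⇒transitive chain ,
    ≤-trans (≤-reflexive (trans (*-identityʳ n) (sym (length-tabulate (λ i → i))))) N≤
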